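{- The family of coverability languages of RPNs strictly includes the union of the family of coverability languages of Petri nets and the family of context-free languages.
   Context: A Recursive Petri Net (RPN) is a tuple $\mathcal N=\langle P,T,W^+,W^-,\Omega\rangle$ where $P$ is a finite set of places, $T=T_{el}\uplus T_{ab}\uplus T_{\tau}$ is a finite set of transitions disjoint from $P$ (elementary, abstract and cut transitions), $W^-\in\mathbb N^{P\times T}$, $W^+\in\mathbb N^{P\times(T_{el}\uplus T_{ab})}$, and $\Omega:T_{ab}\to\mathbb N^P$. Write $W^{\pm}(t)\in\mathbb N^P$ for the column of $t$; markings are compared componentwise. A (concrete) state is either the empty tree $\emptyset$ or a finite rooted tree whose vertices (threads) are taken from a fixed countably infinite set $\mathcal V$, each vertex $v$ labelled by a marking $M_s(v)\in\mathbb N^P$ and each edge labelled by a vector in $\{W^+(t):t\in T_{ab}\}$. Firing rule: a thread $v$ of a state $s\neq\emptyset$ can fire $t$ if $W^-(t)\le M_s(v)$, giving $s\xrightarrow{(v,t)}s'$ where: if $t\in T_{el}$, the marking of $v$ becomes $M_s(v)-W^-(t)+W^+(t)$; if $t\in T_{ab}$, the marking of $v$ becomes $M_s(v)-W^-(t)$ and a new child $w$ of $v$ (a vertex never used before) is created with marking $\Omega(t)$ and edge $v\to w$ labelled $W^+(t)$; if $t\in T_\tau$, the subtree rooted at $v$ is deleted, and if $v$ is the root the result is $\emptyset$, otherwise the marking of the parent $u$ of $v$ is increased by the label of the edge $u\to v$. Quasi-order on states: $\emptyset\preceq s$ for every $s$; for $s\neq\emptyset$, $s\preceq s'$ iff there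 is an injective map $f$ from the vertices of $s$ to those of $s'$ with $M_s(v)\le M_{s'}(f(v))$ for all $v$ and, for every edge $v\to w$ of $s$ labelled $m$, an edge $f(v)\to f(w)$ of $s'$ labelled $m'\ge m$. A labelled RPN has additionally a labelling $\lambda:T\to\Sigma\cup\{\varepsilon\}$ ($\Sigma$ a finite alphabet), extended to sequences as a monoid morphism. For a labelled RPN $\mathcal N$, initial state $s_0$ and finite set of states $S_f$, its coverability language is $\mathcal L_C(\mathcal N,s_0,S_f)=\{\lambda(\sigma)\mid s_0\xrightarrow{\sigma}s,\ s_f\preceq s\text{ for some }s_f\in S_f\}$ ($\sigma$ finite); the family of coverability languages of RPNs consists of all such languages. Similarly the coverability language of a labelled Petri net with initial marking $m_0$ and finite set $F$ of final markings is $\{\lambda(\sigma)\mid m_0\xrightarrow{\sigma}m,\ m\ge m_f\text{ for some }m_f\in F\}$. -}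

module Defs where

open import Data.Nat using (ℕ; _+_; _∸_; _≤_)
open import Data.Fin using (Fin)
open import Data.List using (List; []; _∷_; _++_; [_]; length; lookup; map)
open import Data.List.Relation.Unary.Any using (Any)
open import Data.List.Membership.Propositional using (_∈_)
open import Data.Maybe using (Maybe; just; nothing)
open import Data.Product using (Σ; _×_; _,_; proj₁; proj₂)
open import Data.Sum using (_⊎_; inj₁; inj₂)
open import Data.Unit using (⊤)
open import Data.Empty using (⊥)
open import Relation.Binary.PropositionalEquality using (_≡_)
open import Relation.Binary.Construct.Closure.ReflexiveTransitive using (Star)

Marking : ℕ → Set
Marking n = Fin n → ℕ

_≤ᴹ_ : ∀ {n} → Marking n → Marking n → Set
m ≤ᴹ m' = ∀ p → m p ≤ m' p

_+ᴹ_ : ∀ {n} → Marking n → Marking n → Marking n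
(m +ᴹ m') p = m p + m' p

_∸ᴹ_ : ∀ {n} → Marking n → Marking n → Marking n
(m ∸ᴹ m') p = m p ∸ m' p

labelWord : ∀ {A : Set} {k} → (A → Maybe (Fin k)) → List A → List (Fin k)
labelWord λ' [] = []
labelWord λ' (t ∷ σ) with λ' t
... | nothing = labelWord λ' σ
... | just a  = a ∷ labelWord λ' σ

_≐_ : ∀ {k} → (List (Fin k) → Set) → (List (Fin k) → Set) → Set
L ≐ L' = ∀ w → (L w → L' w) × (L' w → L w)

record RPN (k : ℕ) : Set where
  field
    nP nEl nAb nTau : ℕ
    W⁻el  : Fin nEl → Marking nP
    W⁻ab  : Fin nAb → Marking nP
    W⁻tau : Fin nTau → Marking nP
    W⁺el  : Fin nEl → Marking nP
    W⁺ab  : Fin nAb → Marking nP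
    Ω     : Fin nAb → Marking nP
    lab   : Fin nEl ⊎ Fin nAb ⊎ Fin nTau → Maybe (Fin k)

module RPNSemantics {k : ℕ} (N : RPN k) where
  open RPN N

  Trans : Set
  Trans = Fin nEl ⊎ Fin nAb ⊎ Fin nTau

  W⁻ : Trans → Marking nP
  W⁻ (inj₁ e) = W⁻el e
  W⁻ (inj₂ (inj₁ a)) = W⁻ab a
  W⁻ (inj₂ (inj₂ c)) = W⁻tau c

  -- A nonempty state: finite rooted tree, vertices labelled by markings;
  -- an edge is labelled by W⁺(t) for an abstract transition t, which we
  -- record by t itself (edge label = W⁺ab t).
  data Tree : Set where
    node : Marking nP → List (Fin nAb × Tree) → Tree

  -- A state: nothing = the empty tree ∅
  State : Set
  State = Maybe Tree

  data Fire : Trans → Tree → State → Set where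
    el  : ∀ {e m cs} → W⁻el e ≤ᴹ m →
          Fire (inj₁ e) (node m cs) (just (node ((m ∸ᴹ W⁻el e) +ᴹ W⁺el e) cs))
    ab  : ∀ {a m cs} → W⁻ab a ≤ᴹ m →
          Fire (inj₂ (inj₁ a)) (node m cs)
               (just (node (m ∸ᴹ W⁻ab a) (cs ++ [ (a , node (Ω a) []) ])))
    cut : ∀ {c m cs} → W⁻tau c ≤ᴹ m →
          Fire (inj₂ (inj₂ c)) (node m cs) nothing
    deep : ∀ {t m xs ys a c c'} → Fire t c (just c') →
           Fire t (node m (xs ++ (a , c) ∷ ys)) (just (node m (xs ++ (a , c') ∷ ys)))
    deepCut : ∀ {t m xs ys a c} → Fire t c nothing →
           Fire t (node m (xs ++ (a , c) ∷ ys)) (just (node (m +ᴹ W⁺ab a) (xs ++ ys)))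

  data Step : State → Trans → State → Set where
    step : ∀ {s t r} → Fire t s r → Step (just s) t r

  data Run : State → List Trans → State → Set where
    done : ∀ {s} → Run s [] s
    _◅_  : ∀ {s t s' σ s''} → Step s t s' → Run s' σ s'' → Run s (t ∷ σ) s''

  child : (cs : List (Fin nAb × Tree)) → Fin (length cs) → Tree
  child cs i = proj₂ (lookup cs i)

  data Pos : Tree → Set where
    root : ∀ {s} → Pos s
    sub  : ∀ {m cs} (i : Fin (length cs)) → Pos (child cs i) → Pos (node m cs)

  mark : (s : Tree) → Pos s → Marking nP
  mark (node m cs) root = m
  mark (node m cs) (sub i p) = mark (child cs i) p

  data Edge : (s : Tree) → Pos s → Pos s → Fin nAb → Set where
    top  : ∀ {m cs} (i : Fin (length cs)) →
           Edge (node m cs) root (sub i root) (proj₁ (lookup cs i))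
    down : ∀ {m cs} (i : Fin (length cs)) {p q a} → Edge (child cs i) p q a →
           Edge (node m cs) (sub i p) (sub i q) a

  _⊑_ : Tree → Tree → Set
  s ⊑ s' = Σ (Pos s → Pos s') λ f →
             (∀ x y → f x ≡ f y → x ≡ y) ×
             (∀ v → mark s v ≤ᴹ mark s' (f v)) ×
             (∀ v w a → Edge s v w a →
                Σ (Fin nAb) λ a' → Edge s' (f v) (f w) a' × (W⁺ab a ≤ᴹ W⁺ab a'))

  _≼_ : State → State → Set
  nothing ≼ s = ⊤
  just t ≼ nothing = ⊥
  just t ≼ just t' = t ⊑ t'

  CovLang : State → List State → List (Fin k) → Set
  CovLang s₀ Sf w = Σ (List Trans) λ σ → Σ State λ s →
    Run s₀ σ s × Any (λ sf → sf ≼ s) Sf × labelWord lab σ ≡ w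

IsRPNCovLang : (k : ℕ) → (List (Fin k) → Set) → Set
IsRPNCovLang k L = Σ (RPN k) λ N → let open RPNSemantics N in
  Σ State λ s₀ → Σ (List State) λ Sf → L ≐ CovLang s₀ Sf

record PN (k : ℕ) : Set where
  field
    nP nT : ℕ
    pre post : Fin nT → Marking nP
    lab : Fin nT → Maybe (Fin k)

module PNSemantics {k : ℕ} (N : PN k) where
  open PN N

  data Run : Marking nP → List (Fin nT) → Marking nP → Set where
    done : ∀ {m} → Run m [] m
    fire : ∀ {m t σ m'} → pre t ≤ᴹ m →
           Run ((m ∸ᴹ pre t) +ᴹ post t) σ m' → Run m (t ∷ σ) m'

  CovLang : Marking nP → List (Marking nP) → List (Fin k) → Set
  CovLang m₀ F w = Σ (List (Fin nT)) λ σ → Σ (Marking nP) λ m →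
    Run m₀ σ m × Any (λ mf → mf ≤ᴹ m) F × labelWord lab σ ≡ w

IsPNCovLang : (k : ℕ) → (List (Fin k) → Set) → Set
IsPNCovLang k L = Σ (PN k) λ N → let open PN N; open PNSemantics N in
  Σ (Marking nP) λ m₀ → Σ (List (Marking nP)) λ F → L ≐ CovLang m₀ F

record CFG (k : ℕ) : Set where
  field
    n     : ℕ
    start : Fin n
    rules : List (Fin n × List (Fin n ⊎ Fin k))

module CFGSemantics {k : ℕ} (G : CFG k) where
  open CFG G

  Sym : Set
  Sym = Fin n ⊎ Fin k

  data _⇒_ : List Sym → List Sym → Set where
    rw : ∀ {x y A β} → (A , β) ∈ rules → (x ++ inj₁ A ∷ y) ⇒ (x ++ β ++ y)

  Lang : List (Fin k) → Set
  Lang w = Star _⇒_ [ inj₁ start ] (map inj₂ w)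

IsCFL : (k : ℕ) → (List (Fin k) → Set) → Set
IsCFL k L = Σ (CFG k) λ G → L ≐ CFGSemantics.Lang G

{-# OPTIONS --safe #-}
-- A Petri net is an RPN without abstract transitions.  For a grammar, the places are the
-- suffixes of right-hand sides: a thread holds one token on the suffix that it still has to
-- produce, reads its terminals by elementary transitions and delegates its nonterminals to
-- child threads; the root receives its token, on a place of its own, when the first child returns.
--
-- For strictness, consider an RPN whose root has counters for 𝕒, 𝕓, 𝕔 and where 𝕕 opens and 𝕖
-- closes a thread.  It accepts all 𝕕ⁿ𝕖ⁿ and 𝕒ⁿ𝕓ⁿ𝕔ⁿ, while every accepted word w satisfies
-- |w|_𝕕 = |w|_𝕖 and |w|_𝕔 ≤ |w|_𝕓 ≤ |w|_𝕒.  By Dickson's lemma a Petri net accepting all 𝕕ⁿ𝕖ⁿ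
-- would reach, after some 𝕕ⁱ and 𝕕ʲ with i < j, comparable markings and so accept 𝕕ʲ𝕖ⁱ.
-- In a parse tree of 𝕒ⁿ𝕓ⁿ𝕔ⁿ take a lowest node whose yield contains both 𝕒 and 𝕔, hence
-- all 𝕓's.  For some n ≠ n' these nodes use the same rule; exchanging the yields of single
-- symbols of its right-hand side keeps the inequalities, which are tight at both words, so each
-- exchange changes the numbers of 𝕒, 𝕓 and 𝕔 equally.  No such yield contains both 𝕒 and 𝕔,
-- so the change is 0 and n = n', a contradiction.
module Submission where

open import Defs
open import Data.Nat using (ℕ; zero; suc; _+_; _∸_; _≤_; _<_; z≤n; s≤s; _≤?_)
open import Data.Nat.Properties
open import Data.Nat.Induction using (<-wellFounded)
open import Data.Nat.Tactic.RingSolver using (solve-∀)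
open import Data.Fin as Fin using (Fin; zero; suc; toℕ; combine; remQuot)
open import Data.Fin.Properties as Fin using (pigeonhole; remQuot-combine)
open import Data.List using (List; []; _∷_; _++_; [_]; map; length; lookup; filter; replicate; tails; concatMap)
open import Data.List.Properties using (++-assoc; ++-identityʳ; map-++; ∷-injective; length-++; filter-++; filter-all; filter-none; length-replicate)
open import Data.List.Membership.Propositional using (_∈_)
open import Data.List.Membership.Propositional.Properties using (∈-concatMap⁺; ∈-concatMap⁻; ∈-lookup; ∈-map⁺; ∈-filter⁻; ∈-++⁺ˡ; ∈-++⁺ʳ)
open import Data.List.Relation.Unary.All as All using (All; []; _∷_)
import Data.List.Relation.Unary.All.Properties as All
open import Data.List.Relation.Unary.AllPairs using (AllPairs; []; _∷_)
import Data.List.Relation.Unary.AllPairs.Properties as AllPairs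
open import Data.List.Relation.Unary.Any as Any using (Any; here; there)
open import Data.List.Relation.Unary.Any.Properties using (lookup-index)
open import Data.Maybe using (Maybe; just; nothing)
open import Data.Sum using (_⊎_; inj₁; inj₂)
open import Data.Product using (Σ; ∃; ∃₂; _×_; _,_; proj₁; proj₂)
open import Data.Unit using (⊤; tt)
open import Data.Empty using (⊥-elim)
open import Function using (_∘_)
open import Induction.WellFounded using (Acc; acc)
open import Relation.Nullary using (¬_; Dec; yes; no)
open import Relation.Nullary.Decidable using (_×-dec_)
open import Relation.Binary.PropositionalEquality using (_≡_; _≢_; _≗_; refl; sym; trans; cong; cong₂; subst; subst₂; module ≡-Reasoning)
open import Relation.Binary.Construct.Closure.ReflexiveTransitive as Star using (Star; ε; _◅_; _◅◅_)

Word : ℕ → Set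
Word k = List (Fin k)

labelWord-++ : ∀ {A : Set} {k} (l : A → Maybe (Fin k)) σ τ →
               labelWord l (σ ++ τ) ≡ labelWord l σ ++ labelWord l τ
labelWord-++ l [] τ = refl
labelWord-++ l (t ∷ σ) τ with l t
... | nothing = labelWord-++ l σ τ
... | just a  = cong (a ∷_) (labelWord-++ l σ τ)

-- Petri nets

module _ {k} (N : PN k) where
  open PN N
  private
    module P = PNSemantics N

    asRPN : RPN k
    asRPN = record
      { nP = nP ; nEl = nT ; nAb = 0 ; nTau = 0
      ; W⁻el = pre ; W⁻ab = λ () ; W⁻tau = λ ()
      ; W⁺el = post ; W⁺ab = λ () ; Ω = λ ()
      ; lab = λ { (inj₁ t) → lab t ; (inj₂ (inj₁ ())) ; (inj₂ (inj₂ ())) } }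

    module R = RPNSemantics asRPN
    open R using (node; root; sub; el; ab; cut; deep; deepCut; step; done; _◅_)

    thread : Marking nP → R.State
    thread m = just (node m [])

    labelWord-inj₁ : ∀ σ → labelWord (RPN.lab asRPN) (map inj₁ σ) ≡ labelWord lab σ
    labelWord-inj₁ [] = refl
    labelWord-inj₁ (t ∷ σ) with lab t
    ... | nothing = labelWord-inj₁ σ
    ... | just a  = cong (a ∷_) (labelWord-inj₁ σ)

    run⁺ : ∀ {m σ m'} → P.Run m σ m' → R.Run (thread m) (map inj₁ σ) (thread m')
    run⁺ P.done = done
    run⁺ (P.fire p r) = step (el p) ◅ run⁺ r

    run⁻ : ∀ {m τ s s'} → s ≡ thread m → R.Run s τ s' →
           ∃₂ λ σ m' → τ ≡ map inj₁ σ × s' ≡ thread m' × P.Run m σ m'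
    run⁻ refl done = [] , _ , refl , refl , P.done
    run⁻ refl (step f ◅ r) = go f refl r
      where
      -- The tree stays a variable tied by an equation, since matching on `deep` would otherwise
      -- have to unify `xs ++ (a , c) ∷ ys` with `[]`. Only `el` survives: there are no abstract or
      -- cut transitions.
      go : ∀ {m t τ s s' s''} → R.Fire t s s' → s ≡ node m [] → R.Run s' τ s'' →
           ∃₂ λ σ m' → t ∷ τ ≡ map inj₁ σ × s'' ≡ thread m' × P.Run m σ m'
      go (el p) refl r with run⁻ refl r
      ... | σ , m' , refl , refl , r' = _ ∷ σ , m' , refl , refl , P.fire p r'
      go (ab {a = ()} _) _ _
      go (cut {c = ()} _) _ _
      go (deep {a = ()} _) _ _
      go (deepCut {a = ()} _) _ _

    cover⁺ : ∀ {m m'} → m ≤ᴹ m' → thread m R.≼ thread m'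
    cover⁺ m≤m' = (λ _ → root) , (λ { root root _ → refl }) , (λ { root → m≤m' }) , λ _ _ ()

    cover⁻ : ∀ {m m'} → thread m R.≼ thread m' → m ≤ᴹ m'
    cover⁻ (f , _ , m≤ , _) with f root | m≤ root
    ... | root | p = p

    covers⁺ : ∀ {F m} → Any (_≤ᴹ m) F → Any (R._≼ thread m) (map thread F)
    covers⁺ (Any.here p)  = Any.here (cover⁺ p)
    covers⁺ (Any.there p) = Any.there (covers⁺ p)

    covers⁻ : ∀ {F m} → Any (R._≼ thread m) (map thread F) → Any (_≤ᴹ m) F
    covers⁻ {_ ∷ _} (Any.here p)  = Any.here (cover⁻ p)
    covers⁻ {_ ∷ _} (Any.there p) = Any.there (covers⁻ p)

  PN-CovLang-isRPN : ∀ m₀ F → IsRPNCovLang k (P.CovLang m₀ F)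
  PN-CovLang-isRPN m₀ F = asRPN , thread m₀ , map thread F , λ w →
    (λ { (σ , m , r , c , refl) →
         map inj₁ σ , thread m , run⁺ r , covers⁺ c , labelWord-inj₁ σ }) ,
    (λ { (τ , s , r , c , refl) → case⁻ r c })
    where
    case⁻ : ∀ {τ s} → R.Run (thread m₀) τ s → Any (R._≼ s) (map thread F) →
            P.CovLang m₀ F (labelWord (RPN.lab asRPN) τ)
    case⁻ r c with run⁻ refl r
    ... | σ , m' , refl , refl , r' = σ , m' , r' , covers⁻ c , sym (labelWord-inj₁ σ)

  PN-run-mono : ∀ {m σ m' n} → P.Run m σ m' → m ≤ᴹ n → ∃ λ n' → P.Run n σ n' × m' ≤ᴹ n'
  PN-run-mono P.done m≤n = _ , P.done , m≤n
  PN-run-mono {n = n} (P.fire {m} {t} p r) m≤n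
    with PN-run-mono {n = (n ∸ᴹ pre t) +ᴹ post t} r
           (λ i → +-monoˡ-≤ (post t i) (∸-monoˡ-≤ (pre t i) (m≤n i)))
  ... | n' , r' , le = n' , P.fire (λ i → ≤-trans (p i) (m≤n i)) r' , le

  PN-run-++ : ∀ {m σ m' τ m''} → P.Run m σ m' → P.Run m' τ m'' → P.Run m (σ ++ τ) m''
  PN-run-++ P.done s = s
  PN-run-++ (P.fire p r) s = P.fire p (PN-run-++ r s)

  -- The split is placed right after the transition that emits the last letter of `u`; silent
  -- transitions that follow it go to the second run.
  PN-run-split : ∀ {m σ m'} u {v} → P.Run m σ m' → labelWord lab σ ≡ u ++ v →
    ∃₂ λ σ₁ σ₂ → ∃ λ n → P.Run m σ₁ n × P.Run n σ₂ m' ×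
      labelWord lab σ₁ ≡ u × labelWord lab σ₂ ≡ v
  PN-run-split [] {v} r eq = [] , _ , _ , P.done , r , refl , eq
  PN-run-split (x ∷ u) (P.fire {t = t} p r) eq with lab t in lt
  ... | nothing with PN-run-split (x ∷ u) r eq
  ...   | σ₁ , σ₂ , n , r₁ , r₂ , e₁ , e₂ = t ∷ σ₁ , σ₂ , n , P.fire p r₁ , r₂ , e₁' , e₂
    where
    e₁' : labelWord lab (t ∷ σ₁) ≡ x ∷ u
    e₁' rewrite lt = e₁
  PN-run-split (x ∷ u) (P.fire {t = t} p r) eq | just a with ∷-injective eq
  ... | refl , eq' with PN-run-split u r eq'
  ...   | σ₁ , σ₂ , n , r₁ , r₂ , e₁ , e₂ = t ∷ σ₁ , σ₂ , n , P.fire p r₁ , r₂ , e₁' , e₂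
    where
    e₁' : labelWord lab (t ∷ σ₁) ≡ a ∷ u
    e₁' rewrite lt = cong (a ∷_) e₁

-- Dickson's lemma

-- Negative formulation: the tail minima of an infinite set cannot be located constructively.
Infinite : (ℕ → Set) → Set
Infinite U = ∀ n → ¬ (∀ m → n ≤ m → ¬ U m)

TailMinimum : (ℕ → ℕ) → (ℕ → Set) → ℕ → Set
TailMinimum f U m = U m × (∀ m' → m ≤ m' → U m' → f m ≤ f m')

-- If no tail minimum lay beyond `n`, then by induction on the value `f m` no member of `U` could
-- lie there either: a member that is not a tail minimum is followed by one of smaller value.
tailMinima-infinite : ∀ f {U} → Infinite U → Infinite (TailMinimum f U)
tailMinima-infinite f {U} inf n none = inf n (λ m n≤m um → empty m (<-wellFounded (f m)) n≤m um)
  where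
  empty : ∀ m → Acc _<_ (f m) → n ≤ m → ¬ U m
  empty m (acc rs) n≤m um = none m n≤m (um , minimal)
    where
    minimal : ∀ m' → m ≤ m' → U m' → f m ≤ f m'
    minimal m' m≤m' um' with f m ≤? f m'
    ... | yes le = le
    ... | no nle = ⊥-elim (empty m' (rs (≰⇒> nle)) (≤-trans n≤m m≤m') um')

-- Induction on the dimension. Along its tail minima a coordinate is nondecreasing, and choosing
-- them inside the set found for the other coordinates keeps those monotone.
monotone-on : ∀ {d} (f : ℕ → Marking d) →
  Σ (ℕ → Set) λ U → Infinite U × (∀ {i j} → i ≤ j → U i → U j → f i ≤ᴹ f j)
monotone-on {zero} f = (λ _ → ⊤) , (λ n none → none n ≤-refl tt) , λ _ _ _ ()
monotone-on {suc d} f with monotone-on (λ i p → f i (suc p))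
... | U , inf , mono = TailMinimum (λ i → f i zero) U , tailMinima-infinite _ inf ,
      λ { i≤j (ui , min) (uj , _) zero    → min _ i≤j uj
        ; i≤j (ui , _)   (uj , _) (suc p) → mono i≤j ui uj p }

dickson : ∀ {d} (f : ℕ → Marking d) → ¬ (∀ {i j} → i < j → ¬ (f i ≤ᴹ f j))
dickson f bad with monotone-on f
... | U , inf , mono =
  inf 0 λ i _ ui → inf (suc i) λ j i<j uj → bad i<j (mono (<⇒≤ i<j) ui uj)

-- Let `mid n` be the marking reached after reading `u n`. Whenever `mid i ≤ᴹ mid j`, monotonicity
-- lets the run reading `v i` be replayed from `mid j`, and it still covers a final marking. By
-- Dickson's lemma this comparison cannot fail for all `i < j`.
PN-right-factor-exchange : ∀ {k L} → IsPNCovLang k L → (u v : ℕ → Word k) → (∀ n → L (u n ++ v n)) →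
           ¬ (∀ {i j} → i < j → ¬ L (u j ++ v i))
PN-right-factor-exchange {k} {L} (N , m₀ , F , eqv) u v mem bad = dickson mid swap
  where
  open PN N using (lab)
  module P = PNSemantics N
  halves : ∀ n → ∃₂ λ σ₁ σ₂ → ∃₂ λ m m' → P.Run m₀ σ₁ m × P.Run m σ₂ m' ×
           Any (_≤ᴹ m') F × labelWord lab σ₁ ≡ u n × labelWord lab σ₂ ≡ v n
  halves n with proj₁ (eqv _) (mem n)
  ... | σ , m' , r , c , eq with PN-run-split N (u n) r eq
  ...   | σ₁ , σ₂ , m , r₁ , r₂ , e₁ , e₂ = σ₁ , σ₂ , m , m' , r₁ , r₂ , c , e₁ , e₂
  mid : ℕ → Marking (PN.nP N)
  mid n = proj₁ (proj₂ (proj₂ (halves n)))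
  swap : ∀ {i j} → i < j → ¬ (mid i ≤ᴹ mid j)
  swap {i} {j} i<j le =
    let _ , σ₂ , _ , _ , _ , r₂ , c , _ , e₂ = halves i
        σ₁ , _ , _ , _ , r₁ , _ , _ , e₁ , _ = halves j
        n' , r₂' , le' = PN-run-mono N r₂ le
    in bad i<j (proj₂ (eqv _)
         ( σ₁ ++ σ₂ , n' , PN-run-++ N r₁ r₂' , Any.map (λ p x → ≤-trans (p x) (le' x)) c
         , trans (labelWord-++ lab σ₁ σ₂) (cong₂ _++_ e₁ e₂)))

-- Context-free derivations

module Derivations {k} (G : CFG k) where
  open CFG G
  open CFGSemantics G

  -- A forest of parse trees, one root per symbol. The order of rewriting steps is forgotten, so
  -- yields can be split and exchanged symbol by symbol.
  data Der : List Sym → Word k → Set where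
    []     : Der [] []
    term   : ∀ {a β w} → Der β w → Der (inj₂ a ∷ β) (a ∷ w)
    expand : ∀ {A γ β u v} → (A , γ) ∈ rules → Der γ u → Der β v → Der (inj₁ A ∷ β) (u ++ v)

  Der-++ : ∀ {α β u v} → Der α u → Der β v → Der (α ++ β) (u ++ v)
  Der-++ [] e = e
  Der-++ (term d) e = term (Der-++ d e)
  Der-++ {v = v} (expand {u = u} {v = v'} p d d') e =
    subst (Der _) (sym (++-assoc u v' v)) (expand p d (Der-++ d' e))

  Der-split : ∀ α {β w} → Der (α ++ β) w → ∃₂ λ u v → w ≡ u ++ v × Der α u × Der β v
  Der-split [] d = [] , _ , refl , [] , d
  Der-split (inj₂ a ∷ α) (term d) with Der-split α d
  ... | u , v , refl , d₁ , d₂ = a ∷ u , v , refl , term d₁ , d₂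
  Der-split (inj₁ A ∷ α) (expand {u = u₀} p d d') with Der-split α d'
  ... | u , v , refl , d₁ , d₂ = u₀ ++ u , v , sym (++-assoc u₀ u v) , expand p d d₁ , d₂

  Der-terminals : ∀ w → Der (map inj₂ w) w
  Der-terminals [] = []
  Der-terminals (a ∷ w) = term (Der-terminals w)

  -- Read backwards, a rewriting step gathers the trees above the right-hand side `γ` under one new
  -- node. Folding this over a derivation builds the forest from the terminal word upwards.
  ⇒-Der : ∀ {α β w} → α ⇒ β → Der β w → Der α w
  ⇒-Der (rw {x} {y} {A} {γ} p) d with Der-split x d
  ... | _ , _ , refl , d₁ , d₂ with Der-split γ d₂
  ...   | _ , _ , refl , d₃ , d₄ = Der-++ d₁ (expand p d₃ d₄)

  Lang⇒Der : ∀ {w} → Lang w → Der [ inj₁ start ] w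
  Lang⇒Der {w} ds = Star.fold (λ α β → Der β w → Der α w) (λ s f d → ⇒-Der s (f d)) (λ d → d) ds
                      (Der-terminals w)

  ⇒-++ˡ : ∀ l {α β} → α ⇒ β → (l ++ α) ⇒ (l ++ β)
  ⇒-++ˡ l (rw {x} p) = subst₂ _⇒_ (++-assoc l x _) (++-assoc l x _) (rw {l ++ x} p)

  ⇒-++ʳ : ∀ r {α β} → α ⇒ β → (α ++ r) ⇒ (β ++ r)
  ⇒-++ʳ r (rw {x} {y} {A} {γ} p) = subst₂ _⇒_ (sym (++-assoc x _ r))
    (trans (cong (x ++_) (sym (++-assoc γ y r))) (sym (++-assoc x _ r))) (rw {x} {y ++ r} p)

  Der⇒Star : ∀ {β w} → Der β w → Star _⇒_ β (map inj₂ w)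
  Der⇒Star [] = ε
  Der⇒Star (term {a} d) = Star.gmap (inj₂ a ∷_) (⇒-++ˡ [ inj₂ a ]) (Der⇒Star d)
  Der⇒Star (expand {A} {γ} {β} {u} {v} p d d') =
    subst (Star _⇒_ _) (sym (map-++ inj₂ u v))
      (rw {[]} p ◅ (Star.gmap (_++ β) (⇒-++ʳ β) (Der⇒Star d) ◅◅
                    Star.gmap (map inj₂ u ++_) (⇒-++ˡ (map inj₂ u)) (Der⇒Star d')))

  Der⇒Lang : ∀ {w} → Der [ inj₁ start ] w → Lang w
  Der⇒Lang = Der⇒Star

-- Context-free languages as coverability languages

tails-closed : ∀ {A : Set} {x : A} {β} γ → (x ∷ β) ∈ tails γ → β ∈ tails γ
tails-closed (_ ∷ _) (here refl) = there (here refl)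
tails-closed (_ ∷ γ) (there p)   = there (tails-closed γ p)

-- Together with `++-∷≢[]` this inverts `deep` and `deepCut` at a thread with one child or none,
-- where the index `xs ++ x ∷ ys` does not unify directly.
++-∷≡[-] : ∀ {A : Set} (xs : List A) {x ys y} → xs ++ x ∷ ys ≡ [ y ] → xs ≡ [] × x ≡ y × ys ≡ []
++-∷≡[-] [] refl = refl , refl , refl
++-∷≡[-] (_ ∷ []) ()
++-∷≡[-] (_ ∷ _ ∷ _) ()

++-∷≢[] : ∀ {A : Set} (xs : List A) {x ys} → xs ++ x ∷ ys ≢ []
++-∷≢[] [] ()
++-∷≢[] (_ ∷ _) ()

δ : ∀ {n} → Fin n → Marking n
δ p p' with p Fin.≟ p'
... | yes _ = 1
... | no _  = 0

δ-refl : ∀ {n} (p : Fin n) → δ p p ≡ 1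
δ-refl p with p Fin.≟ p
... | yes _ = refl
... | no ne = ⊥-elim (ne refl)

δ-positive : ∀ {n} {p p' : Fin n} → 1 ≤ δ p p' → p ≡ p'
δ-positive {p = p} {p'} le with p Fin.≟ p'
... | yes eq = eq
δ-positive () | no _

δ≤1 : ∀ {n} (p p' : Fin n) → δ p p' ≤ 1
δ≤1 p p' with p Fin.≟ p'
... | yes _ = s≤s z≤n
... | no _  = z≤n

module _ {k} (N : RPN k) where
  open RPNSemantics N

  Run-++ : ∀ {s σ s' τ s''} → Run s σ s' → Run s' τ s'' → Run s (σ ++ τ) s''
  Run-++ done r = r
  Run-++ (st ◅ r) r' = st ◅ Run-++ r r'

  Run-deep : ∀ {m a c σ c'} → Run (just c) σ (just c') →
             Run (just (node m [ a , c ])) σ (just (node m [ a , c' ]))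
  Run-deep done = done
  Run-deep (_◅_ {s' = just _} (step f) r) = step (deep {xs = []} f) ◅ Run-deep r
  -- The child cannot vanish midway: the empty state has no step, whereas the run ends in a tree.
  Run-deep (_◅_ {s' = nothing} (step f) (() ◅ _))

-- The enumerations of suffixes, rules and calls are parameters so that they do not unfold under
-- `with` and `rewrite`.
module ItemNet {k} (G : CFG k) {Q R C : ℕ}
  (suffix : Fin Q → List (CFGSemantics.Sym G))
  (next : ∀ q {x β} → suffix q ≡ x ∷ β → ∃ λ q' → β ≡ suffix q')
  (axiom : Fin Q) (axiom≡ : suffix axiom ≡ [ inj₁ (CFG.start G) ])
  (rule : Fin R → Fin (CFG.n G) × List (CFGSemantics.Sym G))
  (rule∈ : ∀ r → rule r ∈ CFG.rules G)
  (rule-index : ∀ {ρ} → ρ ∈ CFG.rules G → ∃ λ r → ρ ≡ rule r)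
  (entry : ∀ r → ∃ λ q → proj₂ (rule r) ≡ suffix q)
  (encode : Fin Q → Fin R → Fin C) (decode : Fin C → Fin Q × Fin R)
  (decode-encode : ∀ q r → decode (encode q r) ≡ (q , r))
  where
  open CFG G
  open CFGSemantics G using (Sym; Lang)
  open Derivations G

  private
    lhs : Fin R → Fin n
    lhs r = proj₁ (rule r)

    data Shape (q : Fin Q) : Set where
      end  : suffix q ≡ [] → Shape q
      read : ∀ a q' → suffix q ≡ inj₂ a ∷ suffix q' → Shape q
      call : ∀ A q' → suffix q ≡ inj₁ A ∷ suffix q' → Shape q

    shape : ∀ q → Shape q
    shape q with suffix q in eq
    ... | [] = end eq
    ... | inj₁ A ∷ β with next q eq
    ...   | q' , refl = call A q' eq
    shape q | inj₂ a ∷ β with next q eq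
    ...   | q' , refl = read a q' eq

    nPlaces : ℕ
    nPlaces = suc Q

    at : Fin Q → Marking nPlaces
    at q = δ (suc q)

    accepting : Marking nPlaces
    accepting = δ zero

    -- A thread never holds two tokens, so a transition with this precondition is dead.
    dead : Marking nPlaces
    dead _ = 2

    readPre : ∀ q → Shape q → Marking nPlaces
    readPre q (read _ _ _) = at q
    readPre q _            = dead

    readPost : ∀ q → Shape q → Marking nPlaces
    readPost q (read _ q' _) = at q'
    readPost q _             = dead

    readLabel : ∀ q → Shape q → Maybe (Fin k)
    readLabel q (read a _ _) = just a
    readLabel q _            = nothing

    endPre : ∀ q → Shape q → Marking nPlaces
    endPre q (end _) = at q
    endPre q _       = dead

    callPre : ∀ q → Fin R → Shape q → Marking nPlaces
    callPre q r (call A _ _) with A Fin.≟ lhs r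
    ... | yes _ = at q
    ... | no _  = dead
    callPre q r _ = dead

    callPost : ∀ q → Shape q → Marking nPlaces
    callPost q (call _ q' _) = at q'
    callPost q _             = dead

  -- Abstract transition zero is dead: it only labels the edge below the root of the initial state.
  grammarNet : RPN k
  grammarNet = record
    { nP = nPlaces ; nEl = Q ; nAb = suc C ; nTau = Q
    ; W⁻el  = λ q → readPre q (shape q)
    ; W⁻ab  = λ { zero → dead
                ; (suc i) → let q , r = decode i in callPre q r (shape q) }
    ; W⁻tau = λ q → endPre q (shape q)
    ; W⁺el  = λ q → readPost q (shape q)
    ; W⁺ab  = λ { zero → accepting
                ; (suc i) → let q , r = decode i in callPost q (shape q) }
    ; Ω     = λ { zero → dead
                ; (suc i) → let q , r = decode i in at (proj₁ (entry r)) }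
    ; lab   = λ { (inj₁ q) → readLabel q (shape q) ; (inj₂ _) → nothing } }

  private
    open RPN grammarNet using (W⁻ab; W⁺ab; W⁻el; W⁺el; W⁻tau; Ω; lab)
    open RPNSemantics grammarNet

    initial : Tree
    initial = node (λ _ → 0) [ zero , node (at axiom) [] ]

    final : Tree
    final = node accepting []

    -- What a live abstract transition does, freed from the encoding of pairs and the case
    -- distinction on shapes. The equations are pointwise because markings are functions.
    record Call (q : Fin Q) (i : Fin C) : Set where
      field
        callee : Fin R
        return : Fin Q
        shape≡ : suffix q ≡ inj₁ (lhs callee) ∷ suffix return
        pre≗   : W⁻ab (suc i) ≗ at q
        post≗  : W⁺ab (suc i) ≗ at return
        start≗ : Ω (suc i) ≗ at (proj₁ (entry callee))

    -- The transition stands for a pair of an item and a rule, and it is live only if the rule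
    -- rewrites the nonterminal at the head of the item.
    call-or-dead : ∀ i → ∃ (λ q → Call q i) ⊎ W⁻ab (suc i) ≗ dead
    call-or-dead i with decode i in eq
    ... | q , r with shape q in sh
    ...   | end _      = inj₂ λ _ → refl
    ...   | read _ _ _ = inj₂ λ _ → refl
    ...   | call A q' s with A Fin.≟ lhs r in dec
    ...     | no _     = inj₂ λ _ → refl
    ...     | yes refl = inj₁ (q , record
                { callee = r ; return = q' ; shape≡ = s
                ; pre≗ = pre ; post≗ = post ; start≗ = st })
      where
      pre : W⁻ab (suc i) ≗ at q
      pre p rewrite eq | sh | dec = refl
      post : W⁺ab (suc i) ≗ at q'
      post p rewrite eq | sh = refl
      st : Ω (suc i) ≗ at (proj₁ (entry r))
      st p rewrite eq = refl

    call-exists : ∀ q r {β} → suffix q ≡ inj₁ (lhs r) ∷ β →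
                  ∃ λ i → Σ (Call q i) λ c → Call.callee c ≡ r
    call-exists q r eq with shape q in sh
    ... | end s with trans (sym eq) s
    ...   | ()
    call-exists q r eq | read _ _ s with trans (sym eq) s
    ...   | ()
    call-exists q r eq | call A q' s with trans (sym eq) s
    ...   | refl = i , record { callee = r ; return = q' ; shape≡ = s
                              ; pre≗ = pre ; post≗ = post ; start≗ = st } , refl
      where
      i : Fin C
      i = encode q r
      pre : W⁻ab (suc i) ≗ at q
      pre p rewrite decode-encode q r | sh with lhs r Fin.≟ lhs r
      ... | yes _ = refl
      ... | no ne = ⊥-elim (ne refl)
      post : W⁺ab (suc i) ≗ at q'
      post p rewrite decode-encode q r | sh = refl
      st : Ω (suc i) ≗ at (proj₁ (entry r))
      st p rewrite decode-encode q r = refl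

    -- Soundness of the grammar net

    entry∈ : ∀ r → (lhs r , suffix (proj₁ (entry r))) ∈ rules
    entry∈ r = subst (λ γ → (lhs r , γ) ∈ rules) (proj₂ (entry r)) (rule∈ r)

    step-marking : ∀ {m pre post a b : Marking nPlaces} → m ≗ a → pre ≗ a → post ≗ b →
                   ((m ∸ᴹ pre) +ᴹ post) ≗ b
    step-marking {a = a} {b} m≗ pre≗ post≗ p rewrite m≗ p | pre≗ p | post≗ p | n∸n≡0 (a p) = refl

    spent : ∀ {m pre a : Marking nPlaces} → m ≗ a → pre ≗ a → (m ∸ᴹ pre) ≗ (λ _ → 0)
    spent {a = a} m≗ pre≗ p rewrite m≗ p | pre≗ p = n∸n≡0 (a p)

    dead-disabled : ∀ {m pre : Marking nPlaces} {z} → m ≗ δ z → pre ≗ dead → ¬ pre ≤ᴹ m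
    dead-disabled {z = z} m≗ pre≗ le =
      <-irrefl refl (≤-trans (subst (2 ≤_) (m≗ zero) (subst (_≤ _) (pre≗ zero) (le zero))) (δ≤1 z zero))

    at-enabled : ∀ {m pre : Marking nPlaces} {q z} → m ≗ δ z → pre ≗ at q → pre ≤ᴹ m → z ≡ suc q
    at-enabled {q = q} m≗ pre≗ le = δ-positive (subst (1 ≤_) (m≗ (suc q))
      (subst (_≤ _) (trans (pre≗ (suc q)) (δ-refl (suc q))) (le (suc q))))

    -- The tokens of a state lie at the end of a single branch; the index is the sentential
    -- form that remains to be produced.
    data Remaining : Tree → List Sym → Set where
      active  : ∀ {m q cs} → m ≗ at q → cs ≡ [] → Remaining (node m cs) (suffix q)
      waiting : ∀ {m cs a c q β} → m ≗ (λ _ → 0) → cs ≡ [ a , c ] → W⁺ab a ≗ at q →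
                Remaining c β → Remaining (node m cs) (β ++ suffix q)

    -- The edge to the first child is labelled `accepting`, so the root is empty until that child is
    -- cut and carries the accepting token afterwards.
    data Progress : Tree → List Sym → Set where
      running  : ∀ {m cs c β} → m ≗ (λ _ → 0) → cs ≡ [ zero , c ] → Remaining c β →
                 Progress (node m cs) β
      accepted : ∀ {m cs} → m ≗ accepting → cs ≡ [] → Progress (node m cs) []

    -- Each precondition asks either for two tokens on place `zero`, as part of `dead`, or for a
    -- token on some item place. This covers both the empty and the accepting marking.
    disabled : ∀ {m} t → (∀ q → m (suc q) ≡ 0) → m zero ≤ 1 → ¬ W⁻ t ≤ᴹ m
    disabled (inj₁ q) m0 m1 le with shape q
    ... | end _      = <-irrefl refl (≤-trans (le zero) m1)
    ... | call _ _ _ = <-irrefl refl (≤-trans (le zero) m1)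
    ... | read _ _ _ with ≤-trans (≤-reflexive (sym (δ-refl (suc q)))) (le (suc q))
    ...   | p rewrite m0 q with p
    ...     | ()
    disabled (inj₂ (inj₁ zero)) m0 m1 le = <-irrefl refl (≤-trans (le zero) m1)
    disabled (inj₂ (inj₁ (suc i))) m0 m1 le with call-or-dead i
    ... | inj₂ d = <-irrefl refl (≤-trans (≤-trans (≤-reflexive (sym (d zero))) (le zero)) m1)
    ... | inj₁ (q , c)
      with ≤-trans (≤-reflexive (sym (trans (Call.pre≗ c (suc q)) (δ-refl (suc q))))) (le (suc q))
    ...   | p rewrite m0 q with p
    ...     | ()
    disabled (inj₂ (inj₂ q)) m0 m1 le with shape q
    ... | read _ _ _ = <-irrefl refl (≤-trans (le zero) m1)
    ... | call _ _ _ = <-irrefl refl (≤-trans (le zero) m1)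
    ... | end _ with ≤-trans (≤-reflexive (sym (δ-refl (suc q)))) (le (suc q))
    ...   | p rewrite m0 q with p
    ...     | ()

    zero-disabled : ∀ {m} t → m ≗ (λ _ → 0) → ¬ W⁻ t ≤ᴹ m
    zero-disabled t m0 = disabled t (m0 ∘ suc) (≤-trans (≤-reflexive (m0 zero)) z≤n)

    emit : Trans → Word k → Word k
    emit t w = labelWord lab [ t ] ++ w

    -- Stated backwards: a derivation from the new form yields one from the old form, so soundness
    -- of a run follows by induction from its end. A thread that disappears must have nothing left
    -- to produce, and its cut is silent.
    Outcome : List Sym → Trans → State → Set
    Outcome β t nothing  = β ≡ [] × labelWord lab [ t ] ≡ []
    Outcome β t (just s) = ∃ λ β' → Remaining s β' × (∀ {w} → Der β' w → Der β (emit t w))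

    fire-sound : ∀ {t s r β} → Fire t s r → Remaining s β → Outcome β t r
    fire-sound (el {q} le) (active m≗ refl) with shape q
    ... | end _      = ⊥-elim (dead-disabled m≗ (λ _ → refl) le)
    ... | call _ _ _ = ⊥-elim (dead-disabled m≗ (λ _ → refl) le)
    ... | read a q' s with at-enabled m≗ (λ _ → refl) le
    ...   | refl = suffix q' , active (step-marking m≗ (λ _ → refl) (λ _ → refl)) refl ,
                   λ d → subst (λ β → Der β _) (sym s) (term d)
    fire-sound (ab {zero} le) (active m≗ refl) = ⊥-elim (dead-disabled m≗ (λ _ → refl) le)
    fire-sound (ab {suc i} le) (active m≗ refl) with call-or-dead i
    ... | inj₂ d = ⊥-elim (dead-disabled m≗ d le)
    ... | inj₁ (q , c) with at-enabled m≗ (Call.pre≗ c) le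
    ...   | refl = _ , waiting (spent m≗ (Call.pre≗ c)) refl (Call.post≗ c)
                         (active (Call.start≗ c) refl) , derive
      where
      -- The form of the child is the right-hand side of the called rule; splitting the yield at its
      -- end supplies the node for the nonterminal at the head of `suffix q`.
      derive : ∀ {w} → Der (suffix (proj₁ (entry (Call.callee c))) ++ suffix (Call.return c)) w →
               Der (suffix q) w
      derive d with Der-split (suffix (proj₁ (entry (Call.callee c)))) d
      ... | u , v , refl , d₁ , d₂ =
        subst (λ β → Der β _) (sym (Call.shape≡ c)) (expand (entry∈ (Call.callee c)) d₁ d₂)
    fire-sound (cut {q} le) (active m≗ refl) with shape q
    ... | read _ _ _ = ⊥-elim (dead-disabled m≗ (λ _ → refl) le)
    ... | call _ _ _ = ⊥-elim (dead-disabled m≗ (λ _ → refl) le)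
    ... | end s with at-enabled m≗ (λ _ → refl) le
    ...   | refl = s , refl
    fire-sound (deep {xs = xs} f) (active m≗ eq) = ⊥-elim (++-∷≢[] xs eq)
    fire-sound (deepCut {xs = xs} f) (active m≗ eq) = ⊥-elim (++-∷≢[] xs eq)
    fire-sound (el {e} le) (waiting m≗ eq w≗ v) = ⊥-elim (zero-disabled (inj₁ e) m≗ le)
    fire-sound (ab {a} le) (waiting m≗ eq w≗ v) = ⊥-elim (zero-disabled (inj₂ (inj₁ a)) m≗ le)
    fire-sound (cut {c} le) (waiting m≗ eq w≗ v) = ⊥-elim (zero-disabled (inj₂ (inj₂ c)) m≗ le)
    fire-sound {t} (deep {xs = xs} f) (waiting {q = q} {β} m≗ eq w≗ v) with ++-∷≡[-] xs eq
    ... | refl , refl , refl with fire-sound f v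
    ...   | β' , v' , derive = _ , waiting m≗ refl w≗ v' , derive'
      where
      derive' : ∀ {w} → Der (β' ++ suffix q) w → Der (β ++ suffix q) (emit t w)
      derive' d with Der-split β' d
      ... | u , w , refl , d₁ , d₂ =
        subst (Der _) (++-assoc (labelWord lab [ t ]) u w) (Der-++ (derive d₁) d₂)
    fire-sound {t} (deepCut {xs = xs} f) (waiting m≗ eq w≗ v) with ++-∷≡[-] xs eq
    ... | refl , refl , refl with fire-sound f v
    -- The cut child had nothing left to produce, so the edge label puts the empty parent on its
    -- return item with the remaining form unchanged.
    ...   | refl , silent rewrite silent =
      _ , active (λ p → trans (cong (_+ _) (m≗ p)) (w≗ p)) refl , λ d → d

    not-accepting : ∀ {s β} → Remaining s β → (x : Pos s) → ¬ accepting ≤ᴹ mark s x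
    not-accepting (active m≗ refl) root le with subst (1 ≤_) (m≗ zero) (le zero)
    ... | ()
    not-accepting (waiting m≗ refl _ _) root le with subst (1 ≤_) (m≗ zero) (le zero)
    ... | ()
    not-accepting (waiting _ refl _ v) (sub zero x) le = not-accepting v x le

    -- While the first child exists, place `zero` is empty in every thread, so covering `final`
    -- forces that child to have returned. From then on nothing is enabled and the run is over.
    run-sound : ∀ {s σ s' β} → Progress s β → Run (just s) σ s' → just final ≼ s' →
                Der β (labelWord lab σ)
    run-sound (accepted _ _) done _ = []
    run-sound (running m≗ refl v) done (f , _ , le , _) with f root | le root
    ... | root | p with subst (1 ≤_) (m≗ zero) (p zero)
    ...   | ()
    run-sound (running m≗ refl v) done (f , _ , le , _) | sub zero x | p =
      ⊥-elim (not-accepting v x p)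
    run-sound {σ = t ∷ σ} prog (step f ◅ r) c
      rewrite labelWord-++ lab [ t ] σ = go prog f r
      where
      accepting-disabled : ∀ {m} t → m ≗ accepting → ¬ W⁻ t ≤ᴹ m
      accepting-disabled t m≗ = disabled t (m≗ ∘ suc) (≤-reflexive (m≗ zero))

      go : ∀ {s r β} → Progress s β → Fire t s r → Run r σ _ → Der β (emit t (labelWord lab σ))
      go (accepted m≗ _) (el {e} le) _ = ⊥-elim (accepting-disabled (inj₁ e) m≗ le)
      go (accepted m≗ _) (ab {a} le) _ = ⊥-elim (accepting-disabled (inj₂ (inj₁ a)) m≗ le)
      go (accepted m≗ _) (cut {c} le) _ = ⊥-elim (accepting-disabled (inj₂ (inj₂ c)) m≗ le)
      go (accepted _ eq) (deep {xs = xs} _) _ = ⊥-elim (++-∷≢[] xs eq)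
      go (accepted _ eq) (deepCut {xs = xs} _) _ = ⊥-elim (++-∷≢[] xs eq)
      go (running m≗ _ _) (el {e} le) _ = ⊥-elim (zero-disabled (inj₁ e) m≗ le)
      go (running m≗ _ _) (ab {a} le) _ = ⊥-elim (zero-disabled (inj₂ (inj₁ a)) m≗ le)
      go (running m≗ _ _) (cut {c} le) _ = ⊥-elim (zero-disabled (inj₂ (inj₂ c)) m≗ le)
      go (running m≗ eq v) (deep {xs = xs} f) r with ++-∷≡[-] xs eq
      ... | refl , refl , refl with fire-sound f v
      ...   | β' , v' , derive = derive (run-sound (running m≗ refl v') r c)
      go (running m≗ eq v) (deepCut {xs = xs} f) r with ++-∷≡[-] xs eq
      ... | refl , refl , refl with fire-sound f v
      ...   | refl , silent rewrite silent =
        run-sound (accepted (λ p → cong (_+ _) (m≗ p)) refl) r c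

    -- Completeness of the grammar net

    at⇒≤ : ∀ {m pre : Marking nPlaces} {q} → m ≗ at q → pre ≗ at q → pre ≤ᴹ m
    at⇒≤ m≗ pre≗ p = ≤-reflexive (trans (pre≗ p) (sym (m≗ p)))

    -- The run of a thread up to the moment when it may be cut: it has no child and sits on an item
    -- with empty suffix.
    record Execution (m : Marking nPlaces) (w : Word k) : Set where
      field
        trace   : List Trans
        endM    : Marking nPlaces
        endQ    : Fin Q
        endM≗   : endM ≗ at endQ
        ended   : suffix endQ ≡ []
        run     : Run (just (node m [])) trace (just (node endM []))
        labels  : labelWord lab trace ≡ w

    return-enabled : ∀ {m q} → m ≗ at q → suffix q ≡ [] → W⁻tau q ≤ᴹ m
    return-enabled {q = q} m≗ eq with shape q
    ... | end _ = at⇒≤ m≗ (λ _ → refl)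
    ... | read _ _ s with trans (sym eq) s
    ...   | ()
    return-enabled {q = q} m≗ eq | call _ _ s with trans (sym eq) s
    ...   | ()

    execute : ∀ {β w m q} → Der β w → suffix q ≡ β → m ≗ at q → Execution m w
    execute {q = q} [] eq m≗ = record
      { trace = [] ; endQ = q ; endM≗ = m≗ ; ended = eq ; run = done ; labels = refl }
    execute {m = m} {q} (term {a} {w = w} d) eq m≗ with shape q in sh
    ... | end s with trans (sym eq) s
    ...   | ()
    execute {q = q} (term d) eq m≗ | call _ _ s with trans (sym eq) s
    ...   | ()
    execute {m = m} {q} (term {a} {w = w} d) eq m≗ | read _ q' s with trans (sym eq) s
    ...   | refl = record
      { trace = inj₁ q ∷ E.trace ; endQ = E.endQ ; endM≗ = E.endM≗ ; ended = E.ended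
      ; run = step (el (at⇒≤ m≗ pre≗)) ◅ E.run ; labels = trans (emitted E.trace) (cong (a ∷_) E.labels) }
      where
      pre≗ : W⁻el q ≗ at q
      pre≗ p rewrite sh = refl
      post≗ : W⁺el q ≗ at q'
      post≗ p rewrite sh = refl
      module E = Execution (execute d refl (step-marking {m} {W⁻el q} {W⁺el q} m≗ pre≗ post≗))
      emitted : ∀ τ → labelWord lab (inj₁ q ∷ τ) ≡ a ∷ labelWord lab τ
      emitted τ rewrite sh = refl
    execute {m = m} {q} (expand {u = u} {v} p d d') eq m≗
      with rule-index p
    ... | r , refl with call-exists q r eq
    ...   | i , c , refl with trans (sym eq) (Call.shape≡ c)
    ...     | refl = record
      -- Call the rule, let the child produce `u`, cut it so that the parent receives its return
      -- item, and go on with `v`. The call and the cut are silent.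
      { trace = inj₂ (inj₁ (suc i)) ∷ D.trace ++ inj₂ (inj₂ D.endQ) ∷ E.trace
      ; endQ = E.endQ ; endM≗ = E.endM≗ ; ended = E.ended
      ; run = step (ab (at⇒≤ m≗ (Call.pre≗ c))) ◅
              Run-++ grammarNet (Run-deep grammarNet D.run)
                (step (deepCut {xs = []} (cut (return-enabled D.endM≗ D.ended))) ◅ E.run)
      ; labels = trans (labelWord-++ lab D.trace _) (cong₂ _++_ D.labels E.labels) }
      where
      module D = Execution (execute d (sym (proj₂ (entry r))) (Call.start≗ c))
      module E = Execution (execute d' refl
        (step-marking {m} {W⁻ab (suc i)} {W⁺ab (suc i)} m≗ (Call.pre≗ c) (Call.post≗ c)))

  Lang-isRPN : IsRPNCovLang k Lang
  Lang-isRPN = grammarNet , just initial , [ just final ] , λ w →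
    complete ∘ Lang⇒Der ,
    λ { (σ , s , r , here c , refl) →
          Der⇒Lang (subst (λ β → Der β (labelWord lab σ)) axiom≡
            (run-sound (running (λ _ → refl) refl (active (λ _ → refl) refl)) r c)) }
    where
    complete : ∀ {w} → Der [ inj₁ start ] w → CovLang (just initial) [ just final ] w
    -- The last cut removes the only child of the root and hands the root the token of `accepting`.
    complete d = E.trace ++ [ inj₂ (inj₂ E.endQ) ] , _ ,
      Run-++ grammarNet (Run-deep grammarNet E.run)
        (step (deepCut {xs = []} (cut (return-enabled E.endM≗ E.ended))) ◅ done) ,
      here ((λ _ → root) , (λ { root root _ → refl ; root (sub () _) _ ; (sub () _) _ _ }) ,
            (λ { root p → ≤-refl ; (sub () _) }) , λ { _ _ _ (top ()) ; _ _ _ (down () _) }) ,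
      trans (labelWord-++ lab E.trace _) (trans (++-identityʳ _) E.labels)
      where module E = Execution (execute d axiom≡ (λ _ → refl))

-- The items of a grammar

module _ {k} (G : CFG k) where
  open CFG G
  open CFGSemantics G using (Sym; Lang)

  private
    forms : List (List Sym)
    forms = [ inj₁ start ] ∷ map proj₂ rules

    items : List (List Sym)
    items = concatMap tails forms

    next : ∀ q {x β} → lookup items q ≡ x ∷ β → ∃ λ q' → β ≡ lookup items q'
    next q {x} {β} eq = Any.index tail∈ , lookup-index tail∈
      where
      tail∈ : β ∈ items
      tail∈ = ∈-concatMap⁺ tails (Any.map (λ {γ} → tails-closed γ)
                (∈-concatMap⁻ tails {xs = forms} (subst (_∈ items) eq (∈-lookup q))))

    entry : ∀ r → ∃ λ q → proj₂ (lookup rules r) ≡ lookup items q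
    entry r = Any.index rhs∈ , lookup-index rhs∈
      where
      rhs∈ : proj₂ (lookup rules r) ∈ items
      rhs∈ = ∈-concatMap⁺ tails {xs = forms}
               (there (Any.map (λ { refl → here refl }) (∈-map⁺ proj₂ (∈-lookup r))))

  CFG-Lang-isRPN : IsRPNCovLang k Lang
  -- Index `zero` is the axiom item: `forms` begins with `[ inj₁ start ]`, and `tails` lists the
  -- whole form first.
  CFG-Lang-isRPN = ItemNet.Lang-isRPN G (lookup items) next zero refl (lookup rules) ∈-lookup
    (λ ρ∈ → Any.index ρ∈ , lookup-index ρ∈) entry
    combine (remQuot (length rules)) remQuot-combine

-- A criterion for not being context-free

module LowestNodes {k} (G : CFG k) {P : Word k → Set} (P? : ∀ w → Dec (P w)) where
  open CFG G
  open CFGSemantics G using (Sym)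
  open Derivations G

  -- The condition `¬ P u` concerns only the symbols of the form itself; below them the trees are
  -- arbitrary. For the right-hand side at a node it says that no child of the node has a yield in
  -- `P`.
  data Thin : List Sym → Word k → Set where
    []     : Thin [] []
    term   : ∀ {a β w} → Thin β w → Thin (inj₂ a ∷ β) (a ∷ w)
    expand : ∀ {A γ β u v} → (A , γ) ∈ rules → Der γ u → ¬ P u → Thin β v →
             Thin (inj₁ A ∷ β) (u ++ v)

  Thin⇒Der : ∀ {β w} → Thin β w → Der β w
  Thin⇒Der [] = []
  Thin⇒Der (term d) = term (Thin⇒Der d)
  Thin⇒Der (expand p d _ d') = expand p d (Thin⇒Der d')

  -- A node with yield in `P` none of whose children has one, together with its context: `plug`
  -- replaces the forest below the node by any other forest over the same right-hand side.
  record Lowest (α : List Sym) (w : Word k) : Set where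
    field
      {A}     : Fin n
      {γ}     : List Sym
      {y}     : Word k
      before after : Word k
      rule∈   : (A , γ) ∈ rules
      thin    : Thin γ y
      Py      : P y
      split   : w ≡ before ++ y ++ after
      plug    : ∀ {z} → Der γ z → Der α (before ++ z ++ after)

  -- A node whose yield satisfies `P` either has such a node below it or is lowest itself.
  lowest : ∀ {α w} → Der α w → Lowest α w ⊎ Thin α w
  lowest [] = inj₂ []
  lowest (term {a} d) with lowest d
  ... | inj₂ t = inj₂ (term t)
  ... | inj₁ l = inj₁ record
    { before = a ∷ before ; after = after ; rule∈ = rule∈ ; thin = thin ; Py = Py
    ; split = cong (a ∷_) split ; plug = λ e → term (plug e) }
    where open Lowest l
  lowest (expand {A} {γ} {u = u} {v} p d d') with P? u
  ... | yes Pu with lowest d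
  ...   | inj₂ t = inj₁ record
    { before = [] ; after = v ; rule∈ = p ; thin = t ; Py = Pu
    ; split = refl ; plug = λ e → expand p e d' }
  ...   | inj₁ l = inj₁ record
    { before = before ; after = after ++ v ; rule∈ = rule∈ ; thin = thin ; Py = Py
    ; split = trans (cong (_++ v) split) (assoc y)
    ; plug = λ {z} e → subst (Der _) (assoc z) (expand p (plug e) d') }
    where
    open Lowest l
    assoc : ∀ z → (before ++ z ++ after) ++ v ≡ before ++ z ++ after ++ v
    assoc z = trans (++-assoc before (z ++ after) v) (cong (before ++_) (++-assoc z after v))
  lowest (expand {u = u} {v} p d d') | no ¬Pu with lowest d'
  ...   | inj₂ t = inj₂ (expand p d ¬Pu t)
  ...   | inj₁ l = inj₁ record
    { before = u ++ before ; after = after ; rule∈ = rule∈ ; thin = thin ; Py = Py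
    ; split = trans (cong (u ++_) split) (sym (++-assoc u before _))
    ; plug = λ {z} e → subst (Der _) (sym (++-assoc u before _)) (expand p d (plug e)) }
    where open Lowest l

-- Letter counts and ordered words

cnt : ∀ {k} → Fin k → Word k → ℕ
cnt x w = length (filter (x Fin.≟_) w)

cnt-++ : ∀ {k} (x : Fin k) u v → cnt x (u ++ v) ≡ cnt x u + cnt x v
cnt-++ x u v = trans (cong length (filter-++ (x Fin.≟_) u v)) (length-++ (filter (x Fin.≟_) u))

cnt-comm : ∀ {k} (x : Fin k) u v → cnt x (u ++ v) ≡ cnt x (v ++ u)
cnt-comm x u v = trans (cnt-++ x u v) (trans (+-comm (cnt x u) _) (sym (cnt-++ x v u)))

cnt-replicate-≡ : ∀ {k} (x : Fin k) m → cnt x (replicate m x) ≡ m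
cnt-replicate-≡ x m =
  trans (cong length (filter-all (x Fin.≟_) (All.replicate⁺ m refl))) (length-replicate m)

cnt-replicate-≢ : ∀ {k} {x y : Fin k} m → x ≢ y → cnt x (replicate m y) ≡ 0
cnt-replicate-≢ {x = x} m x≢y = cong length (filter-none (x Fin.≟_) (All.replicate⁺ m x≢y))

cnt-positive⇒∈ : ∀ {k} {x : Fin k} w → 1 ≤ cnt x w → x ∈ w
cnt-positive⇒∈ {x = x} w le with filter (x Fin.≟_) w in eq
cnt-positive⇒∈ {x = x} w (s≤s _) | y ∷ _
  with ∈-filter⁻ (x Fin.≟_) {xs = w} (subst (y ∈_) (sym eq) (here refl))
... | y∈w , refl = y∈w

AllPairs-++⁻ : ∀ {A : Set} {R : A → A → Set} {x y} us {vs} →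
               AllPairs R (us ++ vs) → x ∈ us → y ∈ vs → R x y
AllPairs-++⁻ (_ ∷ us) (r ∷ _) (here refl) y∈ = All.lookup r (∈-++⁺ʳ us y∈)
AllPairs-++⁻ (_ ∷ us) (_ ∷ rs) (there x∈) y∈ = AllPairs-++⁻ us rs x∈ y∈

-- Exchanging factors in words with bounded letter counts

module Interchange {k} (a b c : Fin k) (a<b : a Fin.< b) (b<c : b Fin.< c) where

  -- The surpluses of `b` over `c` and of `a` over `b` are at least as large in `z` as in `y`,
  -- written without subtraction. Surpluses add up under concatenation, so common factors cancel.
  Dominates : Word k → Word k → Set
  Dominates z y = (cnt c z + cnt b y ≤ cnt b z + cnt c y) × (cnt b z + cnt a y ≤ cnt a z + cnt b y)

  private
    exchange : ∀ c₁ b₁ c₂ b₂ p q → (c₁ + p) + (b₂ + q) ≤ (b₁ + q) + (c₂ + p) → c₁ + b₂ ≤ b₁ + c₂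
    exchange c₁ b₁ c₂ b₂ p q le = +-cancelʳ-≤ (p + q) (c₁ + b₂) (b₁ + c₂)
      (subst₂ _≤_ (left c₁ b₂ p q) (right b₁ c₂ p q) le)
      where
      left : ∀ x y p q → (x + p) + (y + q) ≡ (x + y) + (p + q)
      left = solve-∀
      right : ∀ x y p q → (x + q) + (y + p) ≡ (x + y) + (p + q)
      right = solve-∀

  Dominates-cancelʳ : ∀ z y q → Dominates (z ++ q) (y ++ q) → Dominates z y
  Dominates-cancelʳ z y q (le₁ , le₂)
    rewrite cnt-++ a z q | cnt-++ b z q | cnt-++ c z q
          | cnt-++ a y q | cnt-++ b y q | cnt-++ c y q =
    exchange (cnt c z) (cnt b z) (cnt c y) (cnt b y) (cnt c q) (cnt b q) le₁ ,
    exchange (cnt b z) (cnt a z) (cnt b y) (cnt a y) (cnt b q) (cnt a q) le₂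

  Dominates-comm : ∀ p z q y → Dominates (p ++ z) (q ++ y) → Dominates (z ++ p) (y ++ q)
  Dominates-comm p z q y (le₁ , le₂)
    rewrite cnt-comm a p z | cnt-comm b p z | cnt-comm c p z
          | cnt-comm a q y | cnt-comm b q y | cnt-comm c q y = le₁ , le₂

  Dominates-cancelˡ : ∀ p z y → Dominates (p ++ z) (p ++ y) → Dominates z y
  Dominates-cancelˡ p z y = Dominates-cancelʳ z y p ∘ Dominates-comm p z p y

  Wide : Word k → Set
  Wide w = 1 ≤ cnt a w × 1 ≤ cnt c w

  wide? : ∀ w → Dec (Wide w)
  wide? w = (1 ≤? cnt a w) ×-dec (1 ≤? cnt c w)

  narrow : ∀ w → ¬ Wide w → cnt a w ≡ 0 ⊎ cnt c w ≡ 0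
  narrow w ¬wide with cnt a w | cnt c w
  ... | zero  | _     = inj₁ refl
  ... | suc _ | zero  = inj₂ refl
  ... | suc _ | suc _ = ⊥-elim (¬wide (s≤s z≤n , s≤s z≤n))

  private
    -- The hypotheses say that both surpluses agree. If the same letter is missing on both sides,
    -- one equation already identifies `b₁` and `b₂`; if different letters are missing, the two
    -- equations give opposite inequalities.
    balance : ∀ {a₁ b₁ c₁ a₂ b₂ c₂} → c₁ + b₂ ≡ b₁ + c₂ → b₁ + a₂ ≡ a₁ + b₂ →
              a₁ ≡ 0 ⊎ c₁ ≡ 0 → a₂ ≡ 0 ⊎ c₂ ≡ 0 → b₁ ≡ b₂
    balance {b₁ = b₁} e f (inj₁ refl) (inj₁ refl) = trans (sym (+-identityʳ b₁)) f
    balance {b₁ = b₁} e f (inj₂ refl) (inj₂ refl) = sym (trans e (+-identityʳ b₁))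
    balance {b₁ = b₁} {c₁} {a₂} {b₂} e f (inj₁ refl) (inj₂ refl) =
      ≤-antisym (subst (b₁ ≤_) f (m≤m+n b₁ a₂)) (subst (b₂ ≤_) (trans e (+-identityʳ b₁)) (m≤n+m b₂ c₁))
    balance {a₁} {b₁} {b₂ = b₂} {c₂} e f (inj₂ refl) (inj₁ refl) =
      ≤-antisym (subst (b₁ ≤_) (sym e) (m≤m+n b₁ c₂))
        (subst (b₂ ≤_) (trans (sym f) (+-identityʳ b₁)) (m≤n+m b₂ a₁))

  narrow-balance : ∀ y z → Dominates y z → Dominates z y → ¬ Wide y → ¬ Wide z →
                   cnt b y ≡ cnt b z
  narrow-balance y z (p₁ , p₂) (q₁ , q₂) ny nz =
    balance {cnt a y} {cnt b y} {cnt c y}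
      (≤-antisym p₁ (subst₂ _≤_ (+-comm (cnt c z) _) (+-comm (cnt b z) _) q₁))
      (≤-antisym p₂ (subst₂ _≤_ (+-comm (cnt b z) _) (+-comm (cnt a z) _) q₂))
      (narrow y ny) (narrow z nz)

  module _ (G : CFG k) where
    open CFG G
    open Derivations G
    open LowestNodes G wide?

    -- Two derivations of the same form can be mixed symbol by symbol, so if both yields are
    -- extremal then so are their factors, and the factors have equal imbalances.
    thin-balance : ∀ {γ y y'} → Thin γ y → Thin γ y' →
      (∀ {z} → Der γ z → Dominates z y) → (∀ {z} → Der γ z → Dominates z y') → cnt b y ≡ cnt b y'
    thin-balance [] [] _ _ = refl
    thin-balance (term {x} {w = w} t) (term {w = w'} t') ext ext' = begin
      cnt b (x ∷ w)           ≡⟨ cnt-++ b [ x ] w ⟩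
      cnt b [ x ] + cnt b w   ≡⟨ cong (cnt b [ x ] +_) (thin-balance t t'
                                   (λ {z} d → Dominates-cancelˡ [ x ] z w (ext (term d)))
                                   (λ {z} d → Dominates-cancelˡ [ x ] z w' (ext' (term d)))) ⟩
      cnt b [ x ] + cnt b w'  ≡⟨ cnt-++ b [ x ] w' ⟨
      cnt b (x ∷ w')          ∎
      where open ≡-Reasoning
    thin-balance (expand {u = u} {v} p d ¬wide t) (expand {u = u'} {v'} p' d' ¬wide' t') ext ext' = begin
      cnt b (u ++ v)          ≡⟨ cnt-++ b u v ⟩
      cnt b u + cnt b v       ≡⟨ cong₂ _+_
                                   (narrow-balance u u'
                                     (Dominates-cancelʳ u u' v' (ext' (expand p d (Thin⇒Der t'))))
                                     (Dominates-cancelʳ u' u v (ext (expand p' d' (Thin⇒Der t))))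
                                     ¬wide ¬wide')
                                   (thin-balance t t'
                                     (λ {z} e → Dominates-cancelˡ u z v (ext (expand p d e)))
                                     (λ {z} e → Dominates-cancelˡ u' z v' (ext' (expand p' d' e)))) ⟩
      cnt b u' + cnt b v'     ≡⟨ cnt-++ b u' v' ⟨
      cnt b (u' ++ v')        ∎
      where open ≡-Reasoning

  abcPower : ℕ → Word k
  abcPower m = replicate m a ++ replicate m b ++ replicate m c

  private
    a≢b : a ≢ b
    a≢b = Fin.<⇒≢ a<b
    b≢c : b ≢ c
    b≢c = Fin.<⇒≢ b<c
    a≢c : a ≢ c
    a≢c = Fin.<⇒≢ (Fin.<-trans a<b b<c)

    cnt-abc : ∀ x m → cnt x (abcPower m) ≡
              cnt x (replicate m a) + (cnt x (replicate m b) + cnt x (replicate m c))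
    cnt-abc x m = trans (cnt-++ x (replicate m a) _)
                        (cong (cnt x (replicate m a) +_) (cnt-++ x (replicate m b) _))

    cnt-a : ∀ m → cnt a (abcPower m) ≡ m
    cnt-a m
      rewrite cnt-abc a m | cnt-replicate-≡ a m | cnt-replicate-≢ m a≢b | cnt-replicate-≢ m a≢c =
      +-identityʳ m
    cnt-b : ∀ m → cnt b (abcPower m) ≡ m
    cnt-b m
      rewrite cnt-abc b m | cnt-replicate-≡ b m | cnt-replicate-≢ m (a≢b ∘ sym) | cnt-replicate-≢ m b≢c =
      +-identityʳ m
    cnt-c : ∀ m → cnt c (abcPower m) ≡ m
    cnt-c m
      rewrite cnt-abc c m | cnt-replicate-≡ c m | cnt-replicate-≢ m (a≢c ∘ sym) | cnt-replicate-≢ m (b≢c ∘ sym) =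
      refl

    replicate-sorted : ∀ (x : Fin k) m → AllPairs Fin._≤_ (replicate m x)
    replicate-sorted x zero    = []
    replicate-sorted x (suc m) = All.replicate⁺ m ≤-refl ∷ replicate-sorted x m

    abcPower-sorted : ∀ m → AllPairs Fin._≤_ (abcPower m)
    abcPower-sorted m = AllPairs.++⁺ (replicate-sorted a m)
      (AllPairs.++⁺ (replicate-sorted b m) (replicate-sorted c m)
        (All.replicate⁺ m (All.replicate⁺ m (<⇒≤ b<c))))
      (All.replicate⁺ m (All.++⁺ (All.replicate⁺ m (<⇒≤ a<b))
                                 (All.replicate⁺ m (<⇒≤ (<-trans a<b b<c)))))

    -- The word is sorted: a `b` in `u` would precede an `a` of `y`, and a `b` in `v` would follow a
    -- `c` of `y`. Hence every `b` lies in `y`.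
    wide-factor : ∀ m u y v → abcPower m ≡ u ++ y ++ v → Wide y → cnt b y ≡ m
    wide-factor m u y v eq (a≥1 , c≥1) = begin
      cnt b y                       ≡⟨ +-identityʳ _ ⟨
      cnt b y + 0                   ≡⟨ cong (cnt b y +_) none-after ⟨
      cnt b y + cnt b v             ≡⟨ cnt-++ b y v ⟨
      cnt b (y ++ v)                ≡⟨ cong (_+ cnt b (y ++ v)) none-before ⟨
      cnt b u + cnt b (y ++ v)      ≡⟨ cnt-++ b u (y ++ v) ⟨
      cnt b (u ++ y ++ v)           ≡⟨ cong (cnt b) eq ⟨
      cnt b (abcPower m)            ≡⟨ cnt-b m ⟩
      m                             ∎
      where
      open ≡-Reasoning
      sorted : AllPairs Fin._≤_ (u ++ y ++ v)
      sorted = subst (AllPairs Fin._≤_) eq (abcPower-sorted m)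
      none-before : cnt b u ≡ 0
      none-before with 1 ≤? cnt b u
      ... | no ¬b = n<1⇒n≡0 (≰⇒> ¬b)
      ... | yes b≥1 = ⊥-elim (<⇒≱ a<b (AllPairs-++⁻ u sorted (cnt-positive⇒∈ u b≥1)
                                (∈-++⁺ˡ (cnt-positive⇒∈ y a≥1))))
      none-after : cnt b v ≡ 0
      none-after with 1 ≤? cnt b v
      ... | no ¬b = n<1⇒n≡0 (≰⇒> ¬b)
      ... | yes b≥1 = ⊥-elim (<⇒≱ b<c (AllPairs-++⁻ (u ++ y)
              (subst (AllPairs Fin._≤_) (sym (++-assoc u y v)) sorted)
              (∈-++⁺ʳ u (cnt-positive⇒∈ y c≥1)) (cnt-positive⇒∈ v b≥1)))

  not-context-free : ∀ {L} → (∀ m → L (abcPower m)) →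
    (∀ w → L w → cnt c w ≤ cnt b w × cnt b w ≤ cnt a w) → ¬ IsCFL k L
  not-context-free {L} member bound (G , eqv) =
    let i , j , i<j , eq = pigeonhole (n<1+n _) ruleAt
    in <-irrefl (suc-injective (same-rule (toℕ i) (toℕ j) eq)) i<j
    where
    open CFG G
    open Derivations G
    open LowestNodes G wide?

    -- The exponent is shifted by one so that the word is nonempty and thus `Wide`. The start symbol
    -- then has a wide yield, which excludes the `Thin` alternative.
    lowestAt : ∀ m → Lowest [ inj₁ start ] (abcPower (suc m))
    lowestAt m with lowest (Lang⇒Der (proj₁ (eqv _) (member (suc m))))
    ... | inj₁ l = l
    ... | inj₂ t = ⊥-elim (root-wide t refl)
      where
      root-wide : ∀ {w} → Thin [ inj₁ start ] w → ¬ (w ≡ abcPower (suc m))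
      root-wide (expand {u = u} _ _ ¬wide []) eq = ¬wide
        (subst Wide (trans (sym eq) (++-identityʳ u))
          (subst (1 ≤_) (sym (cnt-a (suc m))) (s≤s z≤n) , subst (1 ≤_) (sym (cnt-c (suc m))) (s≤s z≤n)))

    -- One exponent more than there are rules, for the pigeonhole principle.
    ruleAt : Fin (suc (length rules)) → Fin (length rules)
    ruleAt i = Any.index (Lowest.rule∈ (lowestAt (toℕ i)))

    -- The inequalities of `bound` are equalities at `abcPower m`, so every word of the language
    -- dominates it. Plugging in `z` stays in the language, and cancelling the context leaves the
    -- comparison of `z` with the yield of the node.
    extremal : ∀ m (l : Lowest [ inj₁ start ] (abcPower m)) →
               ∀ {z} → Der (Lowest.γ l) z → Dominates z (Lowest.y l)
    extremal m l {z} d = Dominates-cancelʳ z y after (Dominates-cancelˡ before (z ++ after) (y ++ after)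
      (subst (Dominates w) split dominates))
      where
      open Lowest l
      w : Word k
      w = before ++ z ++ after
      dominates : Dominates w (abcPower m)
      dominates rewrite cnt-a m | cnt-b m | cnt-c m =
        let c≤b , b≤a = bound w (proj₂ (eqv w) (Der⇒Lang (plug d)))
        in +-monoˡ-≤ m c≤b , +-monoˡ-≤ m b≤a

    same-form : ∀ m m' (l : Lowest [ inj₁ start ] (abcPower m))
                (l' : Lowest [ inj₁ start ] (abcPower m')) → Lowest.γ l ≡ Lowest.γ l' → m ≡ m'
    same-form m m' l l' refl = begin
      m         ≡⟨ wide-factor m l.before l.y l.after l.split l.Py ⟨
      cnt b l.y   ≡⟨ thin-balance G l.thin l'.thin (extremal m l) (extremal m' l') ⟩
      cnt b l'.y  ≡⟨ wide-factor m' l'.before l'.y l'.after l'.split l'.Py ⟩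
      m'        ∎
      where
      open ≡-Reasoning
      module l = Lowest l
      module l' = Lowest l'

    same-rule : ∀ i j → Any.index (Lowest.rule∈ (lowestAt i)) ≡ Any.index (Lowest.rule∈ (lowestAt j)) →
                suc i ≡ suc j
    same-rule i j eq = same-form (suc i) (suc j) (lowestAt i) (lowestAt j) (cong proj₂ (begin
      _                         ≡⟨ lookup-index (Lowest.rule∈ (lowestAt i)) ⟩
      lookup rules (Any.index (Lowest.rule∈ (lowestAt i)))  ≡⟨ cong (lookup rules) eq ⟩
      lookup rules (Any.index (Lowest.rule∈ (lowestAt j)))  ≡⟨ lookup-index (Lowest.rule∈ (lowestAt j)) ⟨
      _                         ∎))
      where open ≡-Reasoning

-- The separating net

pattern 𝕒 = zero
pattern 𝕓 = suc zero
pattern 𝕔 = suc (suc zero)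
pattern 𝕕 = suc (suc (suc zero))
pattern 𝕖 = suc (suc (suc (suc zero)))

pattern rootP = zero
pattern idleP = suc zero
pattern xP    = suc (suc zero)
pattern yP    = suc (suc (suc zero))

-- `rootP` marks the root and enables the three counting letters. `idleP` says that a thread has no
-- open child: opening one takes the token, and the return of the child gives it back. `xP` holds
-- the 𝕒 not yet matched by a 𝕓, and `yP` the 𝕓 not yet matched by a 𝕔.
counterNet : RPN 5
counterNet = record
  { nP = 4 ; nEl = 3 ; nAb = 1 ; nTau = 1
  ; W⁻el  = λ { 𝕒 → tokens 1 0 0 0 ; 𝕓 → tokens 1 0 1 0 ; 𝕔 → tokens 1 0 0 1 }
  ; W⁻ab  = λ _ → tokens 0 1 0 0
  ; W⁻tau = λ _ → tokens 0 1 0 0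
  ; W⁺el  = λ { 𝕒 → tokens 1 0 1 0 ; 𝕓 → tokens 1 0 0 1 ; 𝕔 → tokens 1 0 0 0 }
  ; W⁺ab  = λ _ → tokens 0 1 0 0
  ; Ω     = λ _ → tokens 0 1 0 0
  ; lab   = λ { (inj₁ 𝕒) → just 𝕒 ; (inj₁ 𝕓) → just 𝕓 ; (inj₁ 𝕔) → just 𝕔
              ; (inj₂ (inj₁ _)) → just 𝕕 ; (inj₂ (inj₂ _)) → just 𝕖 } }
  where
  tokens : ℕ → ℕ → ℕ → ℕ → Marking 4
  tokens r i x y rootP = r
  tokens r i x y idleP = i
  tokens r i x y xP    = x
  tokens r i x y yP    = y

open RPN counterNet using (lab)
open RPNSemantics counterNet

pattern spawn  = inj₂ (inj₁ zero)
pattern return = inj₂ (inj₂ zero)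

startM : Marking 4
startM rootP = 1
startM idleP = 1
startM xP    = 0
startM yP    = 0

startTree : Tree
startTree = node startM []

-- The start state also serves as final state: its token on `rootP` can only be covered at the root,
-- and the one on `idleP` then excludes open children.
CounterLang : Word 5 → Set
CounterLang = CovLang (just startTree) [ just startTree ]

-- Invariants of the separating net

size : Tree → ℕ
sizes : List (Fin 1 × Tree) → ℕ
size (node m cs) = suc (sizes cs)
sizes [] = 0
sizes ((_ , c) ∷ cs) = size c + sizes cs

sizes-++ : ∀ xs ys → sizes (xs ++ ys) ≡ sizes xs + sizes ys
sizes-++ [] ys = refl
sizes-++ ((_ , c) ∷ xs) ys = trans (cong (size c +_) (sizes-++ xs ys)) (sym (+-assoc (size c) _ _))

-- A thread below the root never counts, and it is idle or has an open child but not both. The bound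
-- is kept by opening and by closing a child.
data Inner : Tree → Set where
  inner : ∀ {m cs} → m rootP ≡ 0 → m idleP + length cs ≤ 1 → All (Inner ∘ proj₂) cs →
          Inner (node m cs)

-- Links letters to tree sizes: 𝕕 adds one thread and 𝕖 removes one, so the number of threads below
-- the root is that of the 𝕕 still open.
data Resize : Trans → ℕ → ℕ → Set where
  grow   : ∀ {n} → Resize spawn n (suc n)
  shrink : ∀ {n} → Resize return (suc n) n

Resize-+ : ∀ {t i j} p q → Resize t i j → Resize t (p + (i + q)) (p + (j + q))
Resize-+ p q (grow {n})   rewrite +-suc p (n + q) = grow
Resize-+ p q (shrink {n}) rewrite +-suc p (n + q) = shrink

sizes-middle : ∀ xs {a c} ys → sizes (xs ++ (a , c) ∷ ys) ≡ sizes xs + (size c + sizes ys)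
sizes-middle xs ys = sizes-++ xs _

idle-childless : ∀ {A : Set} {i} {cs : List A} → i + length cs ≤ 1 → 1 ≤ i → cs ≡ []
idle-childless {i = suc i} {[]} _ _ = refl
idle-childless {i = suc i} {c ∷ cs} (s≤s le) _ with i + suc (length cs) | +-suc i (length cs)
idle-childless {i = suc i} {c ∷ cs} (s≤s ()) _ | .(suc (i + length cs)) | refl

call-count : ∀ {A : Set} {i} {cs : List A} {x} → i + length cs ≤ 1 → 1 ≤ i →
             (i ∸ 1) + length (cs ++ [ x ]) ≤ 1
call-count {i = suc i} {cs} {x} le _
  rewrite length-++ cs {[ x ]} | +-comm (length cs) 1 | +-suc i (length cs) = le

return-count : ∀ {A : Set} {i} (xs : List A) {x ys} → i + length (xs ++ x ∷ ys) ≤ 1 →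
               (i + 1) + length (xs ++ ys) ≤ 1
return-count {i = i} xs {x} {ys} le
  rewrite length-++ xs {x ∷ ys} | length-++ xs {ys} | +-suc (length xs) (length ys)
        | +-suc i (length xs + length ys) | +-comm i 1 = le

keep-count : ∀ {A : Set} {i} (xs : List A) {x x' ys} → i + length (xs ++ x ∷ ys) ≤ 1 →
             i + length (xs ++ x' ∷ ys) ≤ 1
keep-count xs {x} {x'} {ys} le rewrite length-++ xs {x ∷ ys} | length-++ xs {x' ∷ ys} = le

All-middle : ∀ {A : Set} {P : A → Set} xs {x x' ys} → All P (xs ++ x ∷ ys) → P x' →
             All P (xs ++ x' ∷ ys)
All-middle xs ps px' with All.++⁻ xs ps
... | pxs , _ ∷ pys = All.++⁺ pxs (px' ∷ pys)

All-drop : ∀ {A : Set} {P : A → Set} xs {x ys} → All P (xs ++ x ∷ ys) → P x × All P (xs ++ ys)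
All-drop xs ps with All.++⁻ xs ps
... | pxs , px ∷ pys = px , All.++⁺ pxs pys


fresh-inner : ∀ {m} → m rootP ≡ 0 → m idleP ≡ 1 → Inner (node m [])
fresh-inner r i = inner r (≤-reflexive (trans (+-identityʳ _) i)) []

fire-inner : ∀ {t s s'} → Fire t s (just s') → Inner s → Inner s' × Resize t (size s) (size s')
-- A cut takes the token on `idleP`, hence the thread is childless and exactly one thread
-- disappears.
fire-cut : ∀ {t s} → Fire t s nothing → Inner s → t ≡ return × size s ≡ 1

fire-inner (el {𝕒} le) (inner r _ _) = ⊥-elim (<-irrefl (sym r) (le rootP))
fire-inner (el {𝕓} le) (inner r _ _) = ⊥-elim (<-irrefl (sym r) (le rootP))
fire-inner (el {𝕔} le) (inner r _ _) = ⊥-elim (<-irrefl (sym r) (le rootP))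
fire-inner (ab {zero} {m} {cs} le) (inner r i cs-inner) =
  inner r (call-count {cs = cs} i (le idleP)) (All.++⁺ cs-inner (fresh-inner refl refl ∷ [])) ,
  subst (Resize spawn _) (cong suc (sym (trans (sizes-++ cs _) (+-comm (sizes cs) 1)))) grow
fire-inner (deep {m = m} {xs} {ys} {a} {c} {c'} f) (inner r i cs-inner) with All-drop xs cs-inner
... | c-inner , _ with fire-inner f c-inner
...   | c'-inner , resize =
  inner r (keep-count xs i) (All-middle xs cs-inner c'-inner) ,
  subst₂ (Resize _) (cong suc (sym (sizes-middle xs ys))) (cong suc (sym (sizes-middle xs ys)))
    (Resize-+ (suc (sizes xs)) (sizes ys) resize)
fire-inner (deepCut {xs = xs} {ys} {zero} {c} f) (inner r i cs-inner) with All-drop xs cs-inner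
... | c-inner , rest-inner with fire-cut f c-inner
...   | refl , c≡1 =
  inner (trans (+-identityʳ _) r) (return-count xs i) rest-inner ,
  subst₂ (Resize return)
    (cong suc (trans (cong (λ n → sizes xs + (n + sizes ys)) (sym c≡1)) (sym (sizes-middle xs ys))))
    (cong suc (sym (sizes-++ xs ys)))
    (Resize-+ (suc (sizes xs)) (sizes ys) shrink)

fire-cut (cut {zero} {cs = cs} le) (inner r i _) with idle-childless {cs = cs} i (le idleP)
... | refl = refl , refl

-- Counter tokens only ever occur in the root thread: the three counter transitions need rootP.
record RootInvariant (w : Word 5) (m : Marking 4) (cs : List (Fin 1 × Tree)) : Set where
  field
    idle     : m idleP + length cs ≤ 1
    children : All (Inner ∘ proj₂) cs
    matched  : cnt 𝕕 w ≡ cnt 𝕖 w + sizes cs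
    x-bound  : cnt 𝕓 w + m xP ≤ cnt 𝕒 w
    y-bound  : cnt 𝕔 w + m yP ≤ cnt 𝕓 w

record Balanced (w : Word 5) : Set where
  field
    𝕕≡𝕖 : cnt 𝕕 w ≡ cnt 𝕖 w
    𝕓≤𝕒 : cnt 𝕓 w ≤ cnt 𝕒 w
    𝕔≤𝕓 : cnt 𝕔 w ≤ cnt 𝕓 w

inner-rootless : ∀ {s} → Inner s → (x : Pos s) → mark s x rootP ≡ 0
children-rootless : ∀ {cs} → All (Inner ∘ proj₂) cs → ∀ j (x : Pos (child cs j)) →
                    mark (child cs j) x rootP ≡ 0
inner-rootless (inner r _ _) root = r
inner-rootless (inner _ _ cs) (sub j x) = children-rootless cs j x
children-rootless (c ∷ _) zero x = inner-rootless c x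
children-rootless (_ ∷ cs) (suc j) x = children-rootless cs j x

cnt-𝕕-Resize : ∀ {t i j} w → Resize t i j → cnt 𝕕 w ≡ cnt 𝕖 w + i →
  let w' = w ++ labelWord lab [ t ] in cnt 𝕕 w' ≡ cnt 𝕖 w' + j
cnt-𝕕-Resize w (grow {n}) eq
  rewrite cnt-++ 𝕕 w [ 𝕕 ] | cnt-++ 𝕖 w [ 𝕕 ] | +-identityʳ (cnt 𝕖 w)
        | +-comm (cnt 𝕕 w) 1 | +-suc (cnt 𝕖 w) n =
  cong suc eq
cnt-𝕕-Resize w (shrink {n}) eq
  rewrite cnt-++ 𝕕 w [ 𝕖 ] | cnt-++ 𝕖 w [ 𝕖 ] | +-identityʳ (cnt 𝕕 w)
        | +-comm (cnt 𝕖 w) 1 | +-suc (cnt 𝕖 w) n = eq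

resize-uncounted : ∀ {t i j} → Resize t i j →
  cnt 𝕒 (labelWord lab [ t ]) ≡ 0 × cnt 𝕓 (labelWord lab [ t ]) ≡ 0 × cnt 𝕔 (labelWord lab [ t ]) ≡ 0
resize-uncounted grow   = refl , refl , refl
resize-uncounted shrink = refl , refl , refl

resize-root : ∀ {w m m' cs cs' t} → RootInvariant w m cs → Resize t (sizes cs) (sizes cs') →
  m' idleP + length cs' ≤ 1 → All (Inner ∘ proj₂) cs' → m' xP ≡ m xP → m' yP ≡ m yP →
  RootInvariant (w ++ labelWord lab [ t ]) m' cs'
resize-root {w} {m} {m'} {t = t} inv rs idle' cs' x≡ y≡ =
  let a0 , b0 , c0 = resize-uncounted rs in record
  { idle = idle' ; children = cs' ; matched = cnt-𝕕-Resize w rs matched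
  ; x-bound = bound 𝕓 𝕒 xP x≡ b0 a0 x-bound ; y-bound = bound 𝕔 𝕓 yP y≡ c0 b0 y-bound }
  where
  open RootInvariant inv
  l : Word 5
  l = labelWord lab [ t ]
  bound : ∀ p q z → m' z ≡ m z → cnt p l ≡ 0 → cnt q l ≡ 0 →
          cnt p w + m z ≤ cnt q w → cnt p (w ++ l) + m' z ≤ cnt q (w ++ l)
  bound p q z z≡ p0 q0 le
    rewrite cnt-++ p w l | cnt-++ q w l | p0 | q0 | z≡ | +-identityʳ (cnt p w) | +-identityʳ (cnt q w) = le

-- Here and in `move` and `same`, the counter `z` is incremented, decremented or left alone; the
-- zeros and ones come from the letter counts and the postconditions.
gain : ∀ {p z q} → p + z ≤ q → (p + 0) + (z + 1) ≤ q + 1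
gain {p} {z} le rewrite +-identityʳ p | sym (+-assoc p z 1) = +-monoˡ-≤ 1 le

move : ∀ {p z q} → 1 ≤ z → p + z ≤ q → (p + 1) + ((z ∸ 1) + 0) ≤ q + 0
move {p} {suc z} {q} _ le rewrite +-identityʳ z | +-identityʳ q | +-assoc p 1 z = le

same : ∀ {p z q} → p + z ≤ q → (p + 0) + (z + 0) ≤ q + 0
same {p} {z} {q} le rewrite +-identityʳ p | +-identityʳ z | +-identityʳ q = le

counter-root : ∀ {w m cs} l (m' : Marking 4) → RootInvariant w m cs →
  cnt 𝕕 [ l ] ≡ 0 → cnt 𝕖 [ l ] ≡ 0 → m' idleP ≡ m idleP + 0 →
  (cnt 𝕓 w + cnt 𝕓 [ l ]) + m' xP ≤ cnt 𝕒 w + cnt 𝕒 [ l ] →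
  (cnt 𝕔 w + cnt 𝕔 [ l ]) + m' yP ≤ cnt 𝕓 w + cnt 𝕓 [ l ] →
  RootInvariant (w ++ [ l ]) m' cs
counter-root {w} {m} {cs} l m' inv d0 e0 i≡ x≤ y≤ = record
  { idle = subst (λ i → i + length cs ≤ 1) (sym (trans i≡ (+-identityʳ _))) idle
  ; children = children ; matched = matched' ; x-bound = x≤' ; y-bound = y≤' }
  where
  open RootInvariant inv
  matched' : cnt 𝕕 (w ++ [ l ]) ≡ cnt 𝕖 (w ++ [ l ]) + sizes cs
  matched' rewrite cnt-++ 𝕕 w [ l ] | cnt-++ 𝕖 w [ l ] | d0 | e0
                 | +-identityʳ (cnt 𝕕 w) | +-identityʳ (cnt 𝕖 w) = matched
  x≤' : cnt 𝕓 (w ++ [ l ]) + m' xP ≤ cnt 𝕒 (w ++ [ l ])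
  x≤' rewrite cnt-++ 𝕓 w [ l ] | cnt-++ 𝕒 w [ l ] = x≤
  y≤' : cnt 𝕔 (w ++ [ l ]) + m' yP ≤ cnt 𝕓 (w ++ [ l ])
  y≤' rewrite cnt-++ 𝕔 w [ l ] | cnt-++ 𝕓 w [ l ] = y≤

fire-root : ∀ {w t m cs m' cs'} → Fire t (node m cs) (just (node m' cs')) → RootInvariant w m cs →
            RootInvariant (w ++ labelWord lab [ t ]) m' cs'
fire-root {w} (el {𝕒} le) inv = counter-root 𝕒 _ inv refl refl refl
  (gain {cnt 𝕓 w} x-bound) (same {cnt 𝕔 w} y-bound)
  where open RootInvariant inv
fire-root {w} (el {𝕓} le) inv = counter-root 𝕓 _ inv refl refl refl
  (move {cnt 𝕓 w} (le xP) x-bound) (gain {cnt 𝕔 w} y-bound)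
  where open RootInvariant inv
fire-root {w} (el {𝕔} le) inv = counter-root 𝕔 _ inv refl refl refl
  (same {cnt 𝕓 w} x-bound) (move {cnt 𝕔 w} (le yP) y-bound)
  where open RootInvariant inv
fire-root (ab {zero} {cs = cs} le) inv = resize-root inv
  (subst (Resize spawn _) (sym (trans (sizes-++ cs _) (+-comm (sizes cs) 1))) grow)
  (call-count {cs = cs} idle (le idleP)) (All.++⁺ children (fresh-inner refl refl ∷ [])) refl refl
  where open RootInvariant inv
fire-root (deep {xs = xs} {ys} f) inv with All-drop xs (RootInvariant.children inv)
... | c-inner , _ with fire-inner f c-inner
...   | c'-inner , resize = resize-root inv
  (subst₂ (Resize _) (sym (sizes-middle xs ys)) (sym (sizes-middle xs ys))
    (Resize-+ (sizes xs) (sizes ys) resize))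
  (keep-count xs (RootInvariant.idle inv)) (All-middle xs (RootInvariant.children inv) c'-inner) refl refl
fire-root (deepCut {xs = xs} {ys} {zero} f) inv with All-drop xs (RootInvariant.children inv)
... | c-inner , rest-inner with fire-cut f c-inner
...   | refl , c≡1 = resize-root inv
  (subst₂ (Resize return)
    (trans (cong (λ n → sizes xs + (n + sizes ys)) (sym c≡1)) (sym (sizes-middle xs ys)))
    (sym (sizes-++ xs ys))
    (Resize-+ (sizes xs) (sizes ys) shrink))
  (return-count xs (RootInvariant.idle inv)) rest-inner (+-identityʳ _) (+-identityʳ _)

-- Only the root can cover the token on `rootP`. Its token on `idleP` then leaves no children, so no
-- 𝕕 is open. Cutting the root leads to the empty state, which has no step and covers no tree.
run-root : ∀ {w m cs σ s} → RootInvariant w m cs → Run (just (node m cs)) σ s →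
           just startTree ≼ s → Balanced (w ++ labelWord lab σ)
run-root {w} {m} {cs} inv done (f , _ , le , _) with f root | le root
... | sub j x | p = ⊥-elim (<-irrefl (sym (children-rootless (RootInvariant.children inv) j x)) (p rootP))
... | root | p with idle-childless {cs = cs} (RootInvariant.idle inv) (p idleP)
...   | refl rewrite ++-identityʳ w = record
  { 𝕕≡𝕖 = trans matched (+-identityʳ _)
  ; 𝕓≤𝕒 = ≤-trans (m≤m+n _ _) x-bound ; 𝕔≤𝕓 = ≤-trans (m≤m+n _ _) y-bound }
  where open RootInvariant inv
run-root {w} {σ = t ∷ σ} inv (_◅_ {s' = just (node _ _)} (step f) r) c
  rewrite labelWord-++ lab [ t ] σ =
  subst Balanced (++-assoc w _ _) (run-root (fire-root f inv) r c)
run-root inv (_◅_ {s' = nothing} _ done) ()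
run-root inv (_◅_ {s' = nothing} _ (() ◅ _)) c

CounterLang-balanced : ∀ {w} → CounterLang w → Balanced w
CounterLang-balanced (σ , s , r , here c , refl) = run-root record
  { idle = ≤-refl ; children = [] ; matched = refl ; x-bound = z≤n ; y-bound = z≤n } r c

self-cover : ∀ m → 1 ≤ m rootP → 1 ≤ m idleP → just startTree ≼ just (node m [])
self-cover m r i = (λ _ → root) , (λ { root root _ → refl ; root (sub () _) _ ; (sub () _) _ _ }) ,
  (λ { root rootP → r ; root idleP → i ; root xP → z≤n ; root yP → z≤n ; (sub () _) }) ,
  λ { _ _ _ (top ()) ; _ _ _ (down () _) }

-- Words accepted by the separating net

Accepts : Tree → Word 5 → Set
Accepts s w = ∃₂ λ σ m → Run (just s) σ (just (node m [])) × labelWord lab σ ≡ w ×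
              1 ≤ m rootP × 1 ≤ m idleP

accepts-CounterLang : ∀ {w} → Accepts startTree w → CounterLang w
accepts-CounterLang (σ , m , r , eq , r≥1 , i≥1) = σ , _ , r , here (self-cover m r≥1 i≥1) , eq

fire-accepts : ∀ {t s s' w} → Fire t s (just s') → Accepts s' w → Accepts s (labelWord lab [ t ] ++ w)
fire-accepts {t} f (σ , m , r , refl , r≥1 , i≥1) =
  t ∷ σ , m , step f ◅ r , labelWord-++ lab [ t ] σ , r≥1 , i≥1

≤+0 : ∀ {n m} → n ≤ m → n ≤ m + 0
≤+0 {m = m} le = ≤-trans le (m≤m+n m 0)

-- The three blocks have independent lengths so that the recursion can consume them letter by
-- letter. The hypotheses say that the present tokens and the letters to come supply each later
-- block.
accepts-counting : ∀ i j l {m} → 1 ≤ m rootP → 1 ≤ m idleP → j ≤ m xP + i → l ≤ m yP + j →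
  Accepts (node m []) (replicate i 𝕒 ++ replicate j 𝕓 ++ replicate l 𝕔)
accepts-counting zero zero zero r≥1 i≥1 _ _ = [] , _ , done , refl , r≥1 , i≥1
accepts-counting zero zero (suc l) {m} r≥1 i≥1 _ y≥ = fire-accepts
  (el {𝕔} λ { rootP → r≥1 ; idleP → z≤n ; xP → z≤n ; yP → ≤-trans (s≤s z≤n) y≥' })
  (accepts-counting zero zero l (m≤n+m 1 _) (≤+0 i≥1) z≤n (≤+0 (≤+0 (∸-monoˡ-≤ 1 y≥'))))
  where
  y≥' : suc l ≤ m yP
  y≥' = subst (suc l ≤_) (+-identityʳ _) y≥
accepts-counting zero (suc j) l {m} r≥1 i≥1 x≥ y≥ = fire-accepts
  (el {𝕓} λ { rootP → r≥1 ; idleP → z≤n ; xP → ≤-trans (s≤s z≤n) x≥' ; yP → z≤n })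
  (accepts-counting zero j l (m≤n+m 1 _) (≤+0 i≥1) (≤+0 (≤+0 (∸-monoˡ-≤ 1 x≥')))
    (subst (l ≤_) (sym (+-assoc (m yP) 1 j)) y≥))
  where
  x≥' : suc j ≤ m xP
  x≥' = subst (suc j ≤_) (+-identityʳ _) x≥
accepts-counting (suc i) j l {m} r≥1 i≥1 x≥ y≥ = fire-accepts
  (el {𝕒} λ { rootP → r≥1 ; idleP → z≤n ; xP → z≤n ; yP → z≤n })
  (accepts-counting i j l (m≤n+m 1 _) (≤+0 i≥1) (subst (j ≤_) (sym (+-assoc (m xP) 1 i)) x≥)
    (subst (λ y → l ≤ y + j) (sym (+-identityʳ _)) y≥))

replicate-∷ʳ : ∀ {A : Set} n (x : A) → replicate n x ++ [ x ] ≡ x ∷ replicate n x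
replicate-∷ʳ zero x = refl
replicate-∷ʳ (suc n) x = cong (x ∷_) (replicate-∷ʳ n x)

-- The child performs the inner nesting recursively and is cut at the end, which restores the idle
-- token. Preservation of `rootP` is stated as an inequality so that one lemma serves both the root
-- and the threads below it.
nested : ∀ n {m} → 1 ≤ m idleP → ∃₂ λ σ m' →
  Run (just (node m [])) σ (just (node m' [])) × labelWord lab σ ≡ replicate n 𝕕 ++ replicate n 𝕖 ×
  m rootP ≤ m' rootP × 1 ≤ m' idleP
nested zero i≥1 = [] , _ , done , refl , ≤-refl , i≥1
nested (suc n) {m} i≥1 with nested n {RPN.Ω counterNet zero} ≤-refl
... | σ , m' , r , eq , _ , i≥1' =
  spawn ∷ σ ++ [ return ] , _ ,
  step (ab λ { rootP → z≤n ; idleP → i≥1 ; xP → z≤n ; yP → z≤n }) ◅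
    Run-++ counterNet (Run-deep counterNet r)
      (step (deepCut {xs = []} (cut λ { rootP → z≤n ; idleP → i≥1' ; xP → z≤n ; yP → z≤n })) ◅ done) ,
  cong (𝕕 ∷_) (begin
    labelWord lab (σ ++ [ return ])                  ≡⟨ labelWord-++ lab σ [ return ] ⟩
    labelWord lab σ ++ [ 𝕖 ]                         ≡⟨ cong (_++ [ 𝕖 ]) eq ⟩
    (replicate n 𝕕 ++ replicate n 𝕖) ++ [ 𝕖 ]        ≡⟨ ++-assoc (replicate n 𝕕) _ _ ⟩
    replicate n 𝕕 ++ (replicate n 𝕖 ++ [ 𝕖 ])        ≡⟨ cong (replicate n 𝕕 ++_) (replicate-∷ʳ n 𝕖) ⟩
    replicate n 𝕕 ++ (𝕖 ∷ replicate n 𝕖)             ∎) ,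
  m≤m+n _ 0 , m≤n+m 1 _
  where open ≡-Reasoning

-- Strictness of the inclusion

open Interchange {5} 𝕒 𝕓 𝕔 (s≤s z≤n) (s≤s (s≤s z≤n)) using (not-context-free)

CounterLang-not-CFL : ¬ IsCFL 5 CounterLang
CounterLang-not-CFL = not-context-free
  (λ m → accepts-CounterLang (accepts-counting m m m ≤-refl ≤-refl ≤-refl ≤-refl))
  λ w w∈L → let balanced = CounterLang-balanced w∈L
            in Balanced.𝕔≤𝕓 balanced , Balanced.𝕓≤𝕒 balanced

CounterLang-not-PN : ¬ IsPNCovLang 5 CounterLang
CounterLang-not-PN pn = PN-right-factor-exchange pn (λ n → replicate n 𝕕) (λ n → replicate n 𝕖)
  (λ n → let σ , m , r , eq , r≥1 , i≥1 = nested n {startM} ≤-refl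
         in accepts-CounterLang (σ , m , r , eq , r≥1 , i≥1))
  λ {i} {j} i<j w∈L → <-irrefl (sym (trans (sym (count-𝕕 j i))
    (trans (Balanced.𝕕≡𝕖 (CounterLang-balanced w∈L)) (count-𝕖 j i)))) i<j
  where
  count-𝕕 : ∀ j i → cnt {5} 𝕕 (replicate j 𝕕 ++ replicate i 𝕖) ≡ j
  count-𝕕 j i = trans (cnt-++ 𝕕 (replicate j 𝕕) _)
    (trans (cong₂ _+_ (cnt-replicate-≡ 𝕕 j) (cnt-replicate-≢ i λ ())) (+-identityʳ j))
  count-𝕖 : ∀ j i → cnt {5} 𝕖 (replicate j 𝕕 ++ replicate i 𝕖) ≡ i
  count-𝕖 j i = trans (cnt-++ 𝕖 (replicate j 𝕕) _)
    (cong₂ _+_ (cnt-replicate-≢ j λ ()) (cnt-replicate-≡ 𝕖 i))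

isRPN-resp : ∀ {k L L'} → L ≐ L' → IsRPNCovLang k L' → IsRPNCovLang k L
isRPN-resp L≐L' (N , s₀ , Sf , L'≐) = N , s₀ , Sf , λ w →
  proj₁ (L'≐ w) ∘ proj₁ (L≐L' w) , proj₂ (L≐L' w) ∘ proj₂ (L'≐ w)

theorem3 : ((k : ℕ) (L : List (Fin k) → Set) →
    IsPNCovLang k L ⊎ IsCFL k L → IsRPNCovLang k L)
    × Σ ℕ (λ k → Σ (List (Fin k) → Set) (λ L →
    IsRPNCovLang k L × ¬ IsPNCovLang k L × ¬ IsCFL k L))
theorem3 =
  (λ { k L (inj₁ (N , m₀ , F , eqv)) → isRPN-resp eqv (PN-CovLang-isRPN N m₀ F)
     ; k L (inj₂ (G , eqv))          → isRPN-resp eqv (CFG-Lang-isRPN G) }) ,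
  5 , CounterLang , (counterNet , just startTree , [ just startTree ] , λ w → (λ p → p) , λ p → p) ,
  CounterLang-not-PN , CounterLang-not-CFL
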